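{- Let $n \ge 2$ be an integer and let $B_1, \dots, B_n$ be pairwise disjoint bases of a matroid of rank $n$. Then there are at least $\left\lfloor \frac{n}{6 \lceil \log n \rceil} \right\rfloor$ pairwise disjoint transversal bases of $(B_1, \dots, B_n)$.
   Context: $\log$ denotes the natural logarithm. A transversal basis of a collection $(B_1, \dots, B_n)$ of sets of elements of a rank-$n$ matroid is a basis of the matroid that contains exactly one element from each of $B_1, \dots, B_n$. -}

module Defs where

open import Data.Nat using (ℕ; zero; suc; _+_; _*_; _∸_; _^_; _≤_; _<_)
open import Data.Nat using (_!)
open import Data.Nat.Combinatorics using (_P_)
open import Data.List using (List; map; upTo)
open import Data.Nat.ListAction using (sum)
open import Data.Fin using (Fin)
open import Data.Fin.Subset using (Subset; ⊥; ⁅_⁆; _∈_; _∉_; _⊆_; _∪_; _∩_; ∣_∣)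
open import Data.Product using (Σ; ∃; _×_; _,_)
open import Data.Sum using (_⊎_)
open import Relation.Binary.PropositionalEquality using (_≡_; _≢_)
open import Relation.Nullary using (¬_)


record Matroid (m : ℕ) : Set₁ where
  field
    Indep      : Subset m → Set
    indep-∅    : Indep ⊥
    indep-⊆    : ∀ {A B} → B ⊆ A → Indep A → Indep B
    indep-exch : ∀ {A B} → Indep A → Indep B → ∣ A ∣ < ∣ B ∣ →
                 ∃ λ x → x ∈ B × x ∉ A × Indep (⁅ x ⁆ ∪ A)

open Matroid public

IsBasis : ∀ {m} → Matroid m → Subset m → Set
IsBasis M B = Indep M B × (∀ x → x ∉ B → ¬ Indep M (⁅ x ⁆ ∪ B))

-- The rank of M is r (some, hence every, basis has r elements).
HasRank : ∀ {m} → Matroid m → ℕ → Set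
HasRank M r = ∃ λ B → IsBasis M B × ∣ B ∣ ≡ r

Disjoint : ∀ {m} → Subset m → Subset m → Set
Disjoint A B = ∀ x → x ∈ A → x ∉ B

IsTransversalBasis : ∀ {m n} → Matroid m → (Fin n → Subset m) → Subset m → Set
IsTransversalBasis M B T = IsBasis M T × (∀ i → ∣ T ∩ B i ∣ ≡ 1)

-- m! * (sum_{j=0}^{m} k^j / j!)  =  sum_{j=0}^{m} k^j * (m!/j!),
-- where m!/j! = m P (m ∸ j).
scaledExpPartial : ℕ → ℕ → ℕ
scaledExpPartial k m = sum (map (λ j → k ^ j * (m P (m ∸ j))) (upTo (suc m)))

-- n ≤ e^k  (e^k is the limit of the increasing partial sums; for n ≥ 2 and
-- k a natural number n ≠ e^k, so this is equivalent to some partial sum being ≥ n).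
LeExp : ℕ → ℕ → Set
LeExp n k = ∃ λ m → n * (m !) ≤ scaledExpPartial k m

-- e^k < n  : every partial sum is < n (and the limit is never an integer ≥ 2).
ExpLt : ℕ → ℕ → Set
ExpLt k n = ∀ m → scaledExpPartial k m < n * (m !)

-- CeilLog n k  :  k = ⌈ log n ⌉ (natural log), i.e.  e^(k-1) < n ≤ e^k,
-- for n ≥ 2 (where necessarily k ≥ 1).
CeilLog : ℕ → ℕ → Set
CeilLog n zero    = n ≤ 1
CeilLog n (suc k) = ExpLt k n × LeExp n (suc k)

{-# OPTIONS --safe #-}
module Submission where

-- Colour the elements of every basis with t colours, let A_j(c) be the elements of B_j of colour c,
-- and apply Rado's theorem to A_1(c), ..., A_n(c) for each colour c: the transversals found for
-- different colours are disjoint. Rado's condition asks that ⋃_{j∈J} A_j(c) has rank at least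
-- s = |J| for all J. For a uniformly random colouring this follows from a coupon-collector
-- estimate: if the rank exposed so far is n - u, the next B_j contains u elements that extend the
-- exposed independent set to a basis, and each of them is missed with probability 1 - 1/t. So the
-- expected number of d-sets of coupons that stay missing, d = n + 1 - s, is C(n,d) (1 - 1/t)^(sd).
-- Because 6kt ≤ n and n ≤ e^k, this is at most n^(-2s-1) or n^(-2(n-s)-2), and the sum
-- over all c and J is less than 1. The colouring is found by conditional expectations, one basis
-- at a time.
--
-- Indep is not assumed decidable. Every independent set below is obtained by augmentation, and in
-- Rado's theorem the choice between deleting x and deleting y is made by comparing cardinalities.

open import Defs
open import Level using (Level)
open import Data.Bool using (Bool; true; false)
open import Data.Nat hiding (_≟_; ∣_-_∣)
open import Data.Nat.Properties hiding (_≟_; suc-injective)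
open import Data.Nat.Combinatorics using (_P_; _C_; nCk≡nC[n∸k]; nCk+nC[k+1]≡[n+1]C[k+1]; k>n⇒nCk≡0)
open import Data.Nat.Combinatorics.Specification using (nP′k≡n[n∸1P′k∸1])
open import Data.Nat.ListAction using (sum)
open import Data.Nat.ListAction.Properties using (sum-++)
open import Data.Nat.Tactic.RingSolver using (solve-∀)
open import Data.Fin using (Fin; zero; suc)
open import Data.Fin.Properties using (_≟_; any?; suc-injective)
open import Data.Fin.Subset using (Subset; inside; outside; ∣_∣; ∁; ⊥; ⊤; ⁅_⁆; _∈_; _∉_; _⊆_; _∪_; _∩_; _-_)
open import Data.Fin.Subset.Properties
open import Data.List using (List; []; _∷_; _++_; [_]; map; upTo; length; allFin; cartesianProductWith)
open import Data.List.Properties using (map-++; map-cong; map-cong-local; map-∘; map-tabulate; length-tabulate; upTo-∷ʳ)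
import Data.List.Membership.Propositional as List
open import Data.List.Membership.Propositional.Properties using (∈-cartesianProductWith⁺; ∈-allFin)
import Data.List.Relation.Unary.Any as Any
open import Data.List.Relation.Unary.All as All using (All; []; _∷_)
import Data.List.Relation.Unary.All.Properties as All
open import Data.Vec as Vec using (Vec; []; _∷_; lookup; here; there)
open import Data.Vec.Properties using (lookup-map; []=⇒lookup; lookup⇒[]=)
open import Data.Sum as Sum using (_⊎_; inj₁; inj₂)
open import Data.Product using (Σ; ∃; ∃₂; _×_; _,_; proj₁; proj₂)
open import Relation.Binary.PropositionalEquality hiding (J; [_])
open import Relation.Nullary using (does; yes; no; contradiction)
open import Function using (_∘_; id)

private variable
  a b c : Level
  A : Set a
  B : Set b
  D : Set c

-- The exponential series

∑ : (A → ℕ) → List A → ℕ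
∑ f xs = sum (map f xs)

∑-++ : ∀ (f : A → ℕ) xs ys → ∑ f (xs ++ ys) ≡ ∑ f xs + ∑ f ys
∑-++ f xs ys = trans (cong sum (map-++ f xs ys)) (sum-++ (map f xs) (map f ys))

∑-cong-local : ∀ {f g : A → ℕ} {xs} → All (λ x → f x ≡ g x) xs → ∑ f xs ≡ ∑ g xs
∑-cong-local eqs = cong sum (map-cong-local eqs)

∑-*ˡ : ∀ c (f : A → ℕ) xs → ∑ (λ x → c * f x) xs ≡ c * ∑ f xs
∑-*ˡ c f []       = sym (*-zeroʳ c)
∑-*ˡ c f (x ∷ xs) = trans (cong (c * f x +_) (∑-*ˡ c f xs)) (sym (*-distribˡ-+ c (f x) (∑ f xs)))

suc-P-suc : ∀ m i → suc m P suc i ≡ suc m * (m P i)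
suc-P-suc m zero = refl
-- Both `P` terms reduce through this one test and are 0 when it fails.
suc-P-suc m (suc i) with i <ᵇ m
... | true  = nP′k≡n[n∸1P′k∸1] (suc m) (suc (suc i))
... | false = sym (*-zeroʳ (suc m))

swap-middle : ∀ a b c → a * (b * c) ≡ b * (a * c)
swap-middle = solve-∀

-- Passing from m! to (m+1)! multiplies every old term by m+1, and the new top term k^(m+1)/(m+1)!
-- becomes k^(m+1).
scaledExpPartial-suc : ∀ k m →
  scaledExpPartial k (suc m) ≡ suc m * scaledExpPartial k m + k ^ suc m
scaledExpPartial-suc k m = begin
  ∑ f (upTo (2 + m))                       ≡⟨ cong (∑ f) (upTo-∷ʳ (suc m)) ⟨
  ∑ f (upTo (suc m) ++ [ suc m ])          ≡⟨ ∑-++ f (upTo (suc m)) [ suc m ] ⟩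
  ∑ f (upTo (suc m)) + (f (suc m) + 0)     ≡⟨ cong₂ _+_ low top ⟩
  suc m * ∑ g (upTo (suc m)) + k ^ suc m   ∎
  where
  open ≡-Reasoning
  f g : ℕ → ℕ
  f j = k ^ j * (suc m P (suc m ∸ j))
  g j = k ^ j * (m P (m ∸ j))
  term : ∀ {j} → j < suc m → f j ≡ suc m * g j
  term {j} (s≤s j≤m) = begin
    k ^ j * (suc m P (suc m ∸ j))     ≡⟨ cong (λ i → k ^ j * (suc m P i)) (+-∸-assoc 1 j≤m) ⟩
    k ^ j * (suc m P suc (m ∸ j))     ≡⟨ cong (k ^ j *_) (suc-P-suc m (m ∸ j)) ⟩
    k ^ j * (suc m * (m P (m ∸ j)))   ≡⟨ swap-middle (k ^ j) (suc m) (m P (m ∸ j)) ⟩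
    suc m * g j                       ∎
  low : ∑ f (upTo (suc m)) ≡ suc m * ∑ g (upTo (suc m))
  low = trans (∑-cong-local (All.map term (All.all-upTo (suc m)))) (∑-*ˡ (suc m) g (upTo (suc m)))
  top : f (suc m) + 0 ≡ k ^ suc m
  top = begin
    f (suc m) + 0                  ≡⟨ +-identityʳ (f (suc m)) ⟩
    k ^ suc m * (suc m P (m ∸ m))  ≡⟨ cong (λ i → k ^ suc m * (suc m P i)) (n∸n≡0 m) ⟩
    k ^ suc m * 1                  ≡⟨ *-identityʳ (k ^ suc m) ⟩
    k ^ suc m                      ∎

-- The rising factorial N(N+1)...(N+m-1) = m! C(N+m-1,m), the scaled coefficient of the binomial
-- series.
rising : ℕ → ℕ → ℕ
rising N zero    = 1
rising N (suc m) = (N + m) * rising N m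

^≤rising : ∀ N m → N ^ m ≤ rising N m
^≤rising N zero    = ≤-refl
^≤rising N (suc m) = *-mono-≤ (m≤m+n N m) (^≤rising N m)

rising-shift : ∀ N m → N * rising (suc N) m ≡ rising N (suc m)
rising-shift N zero    = cong (_* 1) (sym (+-identityʳ N))
rising-shift N (suc m) = begin
  N * ((suc N + m) * rising (suc N) m)   ≡⟨ swap-middle N (suc N + m) (rising (suc N) m) ⟩
  (suc N + m) * (N * rising (suc N) m)   ≡⟨ cong₂ _*_ (sym (+-suc N m)) (rising-shift N m) ⟩
  (N + suc m) * rising N (suc m)         ∎
  where open ≡-Reasoning

-- Pascal's rule for C(N+m+1,m+1), multiplied by (m+1)!.
rising-pascal : ∀ N m → rising (suc N) (suc m) ≡ rising N (suc m) + suc m * rising (suc N) m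
rising-pascal N m = begin
  (suc N + m) * r             ≡⟨ cong (_* r) (sym (+-suc N m)) ⟩
  (N + suc m) * r             ≡⟨ *-distribʳ-+ r N (suc m) ⟩
  N * r + suc m * r           ≡⟨ cong (_+ suc m * r) (rising-shift N m) ⟩
  rising N (suc m) + suc m * r ∎
  where
  open ≡-Reasoning
  r = rising (suc N) m

rising-zero : ∀ m → rising 0 (suc m) ≡ 0
rising-zero zero    = refl
rising-zero (suc m) = trans (cong (suc m *_) (rising-zero m)) (*-zeroʳ (suc m))

-- m! t^m times the m-th partial sum of the binomial series Σ C(N+j-1,j) t^-j
-- of (1 - 1/t)^-N.
negBinomial : ℕ → ℕ → ℕ → ℕ
negBinomial t N zero    = 1
negBinomial t N (suc m) = suc m * (t * negBinomial t N m) + rising N (suc m)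

-- With x = 1/t, multiplying the series of (1-x)^-(N+1) by 1-x gives that of (1-x)^-N. For partial
-- sums S this reads S(N+1,m+1) = S(N,m+1) + x S(N+1,m).
negBinomial-pascal : ∀ t N m →
  negBinomial t (suc N) (suc m) ≡ negBinomial t N (suc m) + suc m * negBinomial t (suc N) m
negBinomial-pascal t N zero = lemma t N
  where
  lemma : ∀ t N → 1 * (t * 1) + (suc N + 0) * 1 ≡ 1 * (t * 1) + (N + 0) * 1 + 1 * 1
  lemma = solve-∀
negBinomial-pascal t N (suc m) = begin
  suc (suc m) * (t * negBinomial t (suc N) (suc m)) + rising (suc N) (2 + m)
    ≡⟨ cong₂ (λ x y → suc (suc m) * (t * x) + y) (negBinomial-pascal t N m) (rising-pascal N (suc m)) ⟩
  suc (suc m) * (t * (f + suc m * f′)) + (r + suc (suc m) * r′)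
    ≡⟨ lemma (suc (suc m)) (suc m) t f f′ r r′ ⟩
  suc (suc m) * (t * f) + r + suc (suc m) * (suc m * (t * f′) + r′) ∎
  where
  open ≡-Reasoning
  f = negBinomial t N (suc m)
  f′ = negBinomial t (suc N) m
  r = rising N (2 + m)
  r′ = rising (suc N) (suc m)
  lemma : ∀ a b t f f′ r r′ →
    a * (t * (f + b * f′)) + (r + a * r′) ≡ a * (t * f) + r + a * (b * (t * f′) + r′)
  lemma = solve-∀

-- In the Pascal recurrence the shorter partial sum S(N+1,m) is at most S(N+1,m+1), because the
-- dropped term is nonnegative. Hence (1-x) S(N+1,m+1) ≤ S(N,m+1) for x = 1/(t+1).
negBinomial-decay : ∀ t N m → t * negBinomial (suc t) (suc N) m ≤ suc t * negBinomial (suc t) N m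
negBinomial-decay t N zero    = *-monoˡ-≤ 1 (n≤1+n t)
negBinomial-decay t N (suc m) = +-cancelˡ-≤ x (t * x) (suc t * y) (begin
  suc t * x                       ≡⟨ cong (suc t *_) (negBinomial-pascal (suc t) N m) ⟩
  suc t * (y + suc m * z)         ≡⟨ lemma (suc t) y (suc m) z ⟩
  suc m * (suc t * z) + suc t * y ≤⟨ +-monoˡ-≤ (suc t * y) (m≤m+n (suc m * (suc t * z)) (rising (suc N) (suc m))) ⟩
  x + suc t * y                   ∎)
  where
  open ≤-Reasoning
  x = negBinomial (suc t) (suc N) (suc m)
  y = negBinomial (suc t) N (suc m)
  z = negBinomial (suc t) (suc N) m
  lemma : ∀ t y m z → t * (y + m * z) ≡ m * (t * z) + t * y
  lemma = solve-∀

negBinomial-zero : ∀ t m → negBinomial t 0 m ≡ m ! * t ^ m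
negBinomial-zero t zero    = refl
negBinomial-zero t (suc m) = begin
  suc m * (t * negBinomial t 0 m) + rising 0 (suc m)
    ≡⟨ cong₂ (λ x y → suc m * (t * x) + y) (negBinomial-zero t m) (rising-zero m) ⟩
  suc m * (t * (m ! * t ^ m)) + 0   ≡⟨ lemma (suc m) t (m !) (t ^ m) ⟩
  suc m * m ! * (t * t ^ m)         ∎
  where
  open ≡-Reasoning
  lemma : ∀ a t b c → a * (t * (b * c)) + 0 ≡ a * b * (t * c)
  lemma = solve-∀

-- N decay steps lead down to exponent 0, where the partial sum is 1.
negBinomial-bound : ∀ t N m → t ^ N * negBinomial (suc t) N m ≤ suc t ^ N * (m ! * suc t ^ m)
negBinomial-bound t zero    m = ≤-reflexive (cong (1 *_) (negBinomial-zero (suc t) m))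
negBinomial-bound t (suc N) m = begin
  t * t ^ N * x                         ≡⟨ lemma t (t ^ N) x ⟩
  t ^ N * (t * x)                       ≤⟨ *-monoʳ-≤ (t ^ N) (negBinomial-decay t N m) ⟩
  t ^ N * (suc t * y)                   ≡⟨ swap-middle (t ^ N) (suc t) y ⟩
  suc t * (t ^ N * y)                   ≤⟨ *-monoʳ-≤ (suc t) (negBinomial-bound t N m) ⟩
  suc t * (suc t ^ N * z)               ≡⟨ *-assoc (suc t) (suc t ^ N) z ⟨
  suc t ^ suc N * z                     ∎
  where
  open ≤-Reasoning
  x = negBinomial (suc t) (suc N) m
  y = negBinomial (suc t) N m
  z = m ! * suc t ^ m
  lemma : ∀ a b c → a * b * c ≡ b * (a * c)
  lemma = solve-∀

^-distribʳ-* : ∀ m n o → (m * n) ^ o ≡ m ^ o * n ^ o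
^-distribʳ-* m n zero    = refl
^-distribʳ-* m n (suc o) = begin
  m * n * (m * n) ^ o         ≡⟨ cong (m * n *_) (^-distribʳ-* m n o) ⟩
  m * n * (m ^ o * n ^ o)     ≡⟨ lemma m n (m ^ o) (n ^ o) ⟩
  m * m ^ o * (n * n ^ o)     ∎
  where
  open ≡-Reasoning
  lemma : ∀ a b c d → a * b * (c * d) ≡ a * c * (b * d)
  lemma = solve-∀

-- A termwise comparison, k^j/j! ≤ C(kt+j-1,j) t^-j, since (kt)^j is at most the rising factorial.
-- It is the partial-sum form of e^k ≤ (1-1/t)^(-kt).
scaledExpPartial≤negBinomial : ∀ t k m → scaledExpPartial k m * t ^ m ≤ negBinomial t (k * t) m
scaledExpPartial≤negBinomial t k zero    = ≤-refl
scaledExpPartial≤negBinomial t k (suc m) = begin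
  scaledExpPartial k (suc m) * t ^ suc m     ≡⟨ cong (_* t ^ suc m) (scaledExpPartial-suc k m) ⟩
  (suc m * e + k ^ suc m) * t ^ suc m        ≡⟨ lemma (suc m) e (k ^ suc m) t (t ^ m) ⟩
  suc m * (t * (e * t ^ m)) + k ^ suc m * t ^ suc m
    ≡⟨ cong (suc m * (t * (e * t ^ m)) +_) (^-distribʳ-* k t (suc m)) ⟨
  suc m * (t * (e * t ^ m)) + (k * t) ^ suc m
    ≤⟨ +-mono-≤ (*-monoʳ-≤ (suc m) (*-monoʳ-≤ t (scaledExpPartial≤negBinomial t k m)))
                (^≤rising (k * t) (suc m)) ⟩
  negBinomial t (k * t) (suc m)              ∎
  where
  open ≤-Reasoning
  e = scaledExpPartial k m
  lemma : ∀ a e p t q → (a * e + p) * (t * q) ≡ a * (t * (e * q)) + p * (t * q)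
  lemma = solve-∀

-- (1 - 1/t)^(kt) ≤ e^-k ≤ 1/n.
LeExp⇒decay : ∀ n k t → LeExp n k → n * t ^ (k * suc t) ≤ suc t ^ (k * suc t)
LeExp⇒decay n k t (m , n≤e^k) = *-cancelʳ-≤ _ _ (m ! * suc t ^ m) {{nz}} (begin
  n * p * (m ! * q)               ≡⟨ lemma n p (m !) q ⟩
  p * (n * m ! * q)               ≤⟨ *-monoʳ-≤ p (*-monoˡ-≤ q n≤e^k) ⟩
  p * (scaledExpPartial k m * q)  ≤⟨ *-monoʳ-≤ p (scaledExpPartial≤negBinomial (suc t) k m) ⟩
  p * negBinomial (suc t) (k * suc t) m  ≤⟨ negBinomial-bound t (k * suc t) m ⟩
  suc t ^ (k * suc t) * (m ! * q) ∎)
  where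
  open ≤-Reasoning
  p = t ^ (k * suc t)
  q = suc t ^ m
  nz : NonZero (m ! * suc t ^ m)
  nz = m*n≢0 (m !) (suc t ^ m) {{m !≢0}} {{m^n≢0 (suc t) m}}
  lemma : ∀ a b c d → a * b * (c * d) ≡ b * (a * c * d)
  lemma = solve-∀

-- Union bound over colours and index sets

∑-cong : ∀ {f g : A → ℕ} → (∀ x → f x ≡ g x) → ∀ xs → ∑ f xs ≡ ∑ g xs
∑-cong eq xs = cong sum (map-cong eq xs)

∑-mono : ∀ {f g : A → ℕ} → (∀ x → f x ≤ g x) → ∀ xs → ∑ f xs ≤ ∑ g xs
∑-mono le []       = z≤n
∑-mono le (x ∷ xs) = +-mono-≤ (le x) (∑-mono le xs)

∑-+ : ∀ (f g : A → ℕ) xs → ∑ (λ x → f x + g x) xs ≡ ∑ f xs + ∑ g xs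
∑-+ f g []       = refl
∑-+ f g (x ∷ xs) = trans (cong (f x + g x +_) (∑-+ f g xs)) (lemma (f x) (g x) (∑ f xs) (∑ g xs))
  where
  lemma : ∀ a b c d → a + b + (c + d) ≡ a + c + (b + d)
  lemma = solve-∀

∑-const : ∀ k (xs : List A) → ∑ (λ _ → k) xs ≡ length xs * k
∑-const k []       = refl
∑-const k (x ∷ xs) = cong (k +_) (∑-const k xs)

∑-map : ∀ (f : B → ℕ) (g : A → B) xs → ∑ f (map g xs) ≡ ∑ (f ∘ g) xs
∑-map f g xs = cong sum (sym (map-∘ xs))

∑-cartesianProductWith : ∀ (f : D → ℕ) (g : A → B → D) xs ys →
  ∑ f (cartesianProductWith g xs ys) ≡ ∑ (λ x → ∑ (f ∘ g x) ys) xs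
∑-cartesianProductWith f g []       ys = refl
∑-cartesianProductWith f g (x ∷ xs) ys =
  trans (∑-++ f (map (g x) ys) (cartesianProductWith g xs ys))
        (cong₂ _+_ (∑-map f (g x) ys) (∑-cartesianProductWith f g xs ys))

vectors : List A → ∀ n → List (Vec A n)
vectors xs zero    = [] ∷ []
vectors xs (suc n) = cartesianProductWith _∷_ xs (vectors xs n)

subsets : ∀ n → List (Subset n)
subsets = vectors (outside ∷ inside ∷ [])

-- The binomial theorem: J records which of the n factors x + y contribute x.
∑-subsets : ∀ x y n → ∑ (λ J → x ^ ∣ J ∣ * y ^ ∣ ∁ J ∣) (subsets n) ≡ (x + y) ^ n
∑-subsets x y zero    = refl
∑-subsets x y (suc n) = begin
  ∑ w (subsets (suc n))
    ≡⟨ ∑-cartesianProductWith w _∷_ (outside ∷ inside ∷ []) (subsets n) ⟩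
  ∑ (λ J → x ^ ∣ J ∣ * (y * y ^ ∣ ∁ J ∣)) (subsets n) +
    (∑ (λ J → x * x ^ ∣ J ∣ * y ^ ∣ ∁ J ∣) (subsets n) + 0)
    ≡⟨ cong₂ (λ p q → p + (q + 0)) out in′ ⟩
  y * s + (x * s + 0)
    ≡⟨ lemma x y s ⟩
  (x + y) * s
    ≡⟨ cong ((x + y) *_) (∑-subsets x y n) ⟩
  (x + y) ^ suc n ∎
  where
  open ≡-Reasoning
  w : ∀ {n} → Subset n → ℕ
  w J = x ^ ∣ J ∣ * y ^ ∣ ∁ J ∣
  s = ∑ w (subsets n)
  out : ∑ (λ J → x ^ ∣ J ∣ * (y * y ^ ∣ ∁ J ∣)) (subsets n) ≡ y * s
  out = trans (∑-cong (λ J → swap-middle (x ^ ∣ J ∣) y (y ^ ∣ ∁ J ∣)) (subsets n)) (∑-*ˡ y w (subsets n))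
  in′ : ∑ (λ J → x * x ^ ∣ J ∣ * y ^ ∣ ∁ J ∣) (subsets n) ≡ x * s
  in′ = trans (∑-cong (λ J → *-assoc x (x ^ ∣ J ∣) (y ^ ∣ ∁ J ∣)) (subsets n)) (∑-*ˡ x w (subsets n))
  lemma : ∀ x y s → y * s + (x * s + 0) ≡ (x + y) * s
  lemma = solve-∀

C≤^ : ∀ n k → n C k ≤ n ^ k
C≤^ n       zero    = ≤-refl
C≤^ zero    (suc k) = z≤n
C≤^ (suc n) (suc k) = begin
  suc n C suc k           ≡⟨ nCk+nC[k+1]≡[n+1]C[k+1] n k ⟨
  n C k + n C suc k       ≤⟨ +-mono-≤ (C≤^ n k) (C≤^ n (suc k)) ⟩
  n ^ k + n * n ^ k       ≤⟨ *-monoʳ-≤ (suc n) (^-monoˡ-≤ k (n≤1+n n)) ⟩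
  suc n * suc n ^ k       ∎
  where open ≤-Reasoning

-- The cube of `decay` uses 3p of the d factors a/b and gains n^-3; the other d - 3p factors are at
-- most 1. The result is raised to the power s.
decay-power : ∀ n p {a b d} → a ≤ b → n * a ^ p ≤ b ^ p → 3 * p ≤ d → ∀ s →
              n ^ (3 * s) * a ^ (d * s) ≤ b ^ (d * s)
decay-power n p {a} {b} {d} a≤b decay 3p≤d s = begin
  n ^ (3 * s) * a ^ (d * s)   ≡⟨ cong₂ _*_ (^-*-assoc n 3 s) (^-*-assoc a d s) ⟨
  (n ^ 3) ^ s * (a ^ d) ^ s   ≡⟨ ^-distribʳ-* (n ^ 3) (a ^ d) s ⟨
  (n ^ 3 * a ^ d) ^ s         ≤⟨ ^-monoˡ-≤ s cube ⟩
  (b ^ d) ^ s                 ≡⟨ ^-*-assoc b d s ⟩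
  b ^ (d * s)                 ∎
  where
  open ≤-Reasoning
  r = d ∸ 3 * p
  split : ∀ x → x ^ d ≡ (x ^ p) ^ 3 * x ^ r
  split x = begin-equality
    x ^ d                ≡⟨ cong (x ^_) (m+[n∸m]≡n 3p≤d) ⟨
    x ^ (3 * p + r)      ≡⟨ cong (λ q → x ^ (q + r)) (*-comm 3 p) ⟩
    x ^ (p * 3 + r)      ≡⟨ ^-distribˡ-+-* x (p * 3) r ⟩
    x ^ (p * 3) * x ^ r  ≡⟨ cong (_* x ^ r) (^-*-assoc x p 3) ⟨
    (x ^ p) ^ 3 * x ^ r  ∎
  cube : n ^ 3 * a ^ d ≤ b ^ d
  cube = begin
    n ^ 3 * a ^ d                    ≡⟨ cong (n ^ 3 *_) (split a) ⟩
    n ^ 3 * ((a ^ p) ^ 3 * a ^ r)    ≡⟨ *-assoc (n ^ 3) ((a ^ p) ^ 3) (a ^ r) ⟨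
    n ^ 3 * (a ^ p) ^ 3 * a ^ r      ≡⟨ cong (_* a ^ r) (^-distribʳ-* n (a ^ p) 3) ⟨
    (n * a ^ p) ^ 3 * a ^ r          ≤⟨ *-mono-≤ (^-monoˡ-≤ 3 decay) (^-monoˡ-≤ r a≤b) ⟩
    (b ^ p) ^ 3 * b ^ r              ≡⟨ split b ⟨
    b ^ d                            ∎

-- The common end of both cases of `weight-bound`: the binomial coefficient c costs n^r, the decay
-- of x pays n^m, and the equation between f and y records what is left over.
power-combine : ∀ n b r m e x D {c f y} → c ≤ n ^ r → n ^ r * f ≡ n ^ m * y → n ^ m * x ≤ b ^ D →
                c * (x * b ^ e) * f ≤ b ^ (e + D) * y
power-combine n b r m e x D {c} {f} {y} c≤ eq x≤ = begin
  c * (x * b ^ e) * f         ≤⟨ *-monoˡ-≤ f (*-monoˡ-≤ (x * b ^ e) c≤) ⟩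
  n ^ r * (x * b ^ e) * f     ≡⟨ lemma₁ (n ^ r) x (b ^ e) f ⟩
  b ^ e * (n ^ r * f * x)     ≡⟨ cong (λ z → b ^ e * (z * x)) eq ⟩
  b ^ e * (n ^ m * y * x)     ≡⟨ lemma₂ (b ^ e) (n ^ m) y x ⟩
  b ^ e * (n ^ m * x) * y     ≤⟨ *-monoˡ-≤ y (*-monoʳ-≤ (b ^ e) x≤) ⟩
  b ^ e * b ^ D * y           ≡⟨ cong (_* y) (^-distribˡ-+-* b e D) ⟨
  b ^ (e + D) * y             ∎
  where
  open ≤-Reasoning
  lemma₁ : ∀ c x y z → c * (x * y) * z ≡ y * (c * z * x)
  lemma₁ = solve-∀
  lemma₂ : ∀ y c w x → y * (c * w * x) ≡ y * (c * x) * w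
  lemma₂ = solve-∀

-- Whichever of s and d is smaller, 6p ≤ n makes 3p at most the other one, so the decay
-- (a/b)^(ds) ≤ n^(-3 min(s,d)) beats the binomial coefficient C(n,d) = C(n,s-1).
weight-bound : ∀ n p {a b} → a ≤ b → n * a ^ p ≤ b ^ p → 6 * p ≤ n →
  ∀ s d e → suc s + d ≡ n →
  (n C suc d) * (a ^ (suc d * suc s) * b ^ e) * n ^ (2 * suc n)
    ≤ b ^ (e + suc d * suc s) * (n * (n ^ 2) ^ d + (n ^ 2) ^ suc s)
weight-bound n p {a} {b} a≤b decay 6p≤n s d e s+d≡n with ≤-total s d
... | inj₁ s≤d = begin
  (n C suc d) * (x * b ^ e) * n ^ (2 * suc n)
    ≤⟨ power-combine n b s (3 * suc s) e x (suc d * suc s) C≤ exponents (decay-power n p a≤b decay 3p≤1+d (suc s)) ⟩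
  b ^ (e + suc d * suc s) * (n * (n ^ 2) ^ d)
    ≤⟨ *-monoʳ-≤ (b ^ (e + suc d * suc s)) (m≤m+n (n * (n ^ 2) ^ d) ((n ^ 2) ^ suc s)) ⟩
  b ^ (e + suc d * suc s) * (n * (n ^ 2) ^ d + (n ^ 2) ^ suc s) ∎
  where
  open ≤-Reasoning
  x = a ^ (suc d * suc s)
  C≤ : n C suc d ≤ n ^ s
  C≤ = subst (_≤ n ^ s) (sym (trans
    (nCk≡nC[n∸k] (subst (suc d ≤_) s+d≡n (s≤s (m≤n+m d s))))
    (cong (n C_) (trans (cong (_∸ suc d) (trans (sym s+d≡n) (sym (+-suc s d)))) (m+n∸n≡m s (suc d))))))
    (C≤^ n s)
  3p≤1+d : 3 * p ≤ suc d
  3p≤1+d = *-cancelˡ-≤ 2 (begin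
    2 * (3 * p)      ≡⟨ *-assoc 2 3 p ⟨
    6 * p            ≤⟨ 6p≤n ⟩
    n                ≡⟨ s+d≡n ⟨
    suc s + d        ≤⟨ +-mono-≤ (s≤s s≤d) (n≤1+n d) ⟩
    suc d + suc d    ≡⟨ cong (suc d +_) (+-identityʳ (suc d)) ⟨
    2 * suc d        ∎)
  -- What is left over is n^(2d+1) here and n^(2(s+1)) in the other case; these are the two summands
  -- of the bound.
  exponents : n ^ s * n ^ (2 * suc n) ≡ n ^ (3 * suc s) * (n * (n ^ 2) ^ d)
  exponents = begin-equality
    n ^ s * n ^ (2 * suc n)                ≡⟨ ^-distribˡ-+-* n s (2 * suc n) ⟨
    n ^ (s + 2 * suc n)                    ≡⟨ cong (λ y → n ^ (s + 2 * suc y)) s+d≡n ⟨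
    n ^ (s + 2 * suc (suc s + d))          ≡⟨ cong (n ^_) (arith s d) ⟩
    n ^ (3 * suc s + suc (2 * d))          ≡⟨ ^-distribˡ-+-* n (3 * suc s) (suc (2 * d)) ⟩
    n ^ (3 * suc s) * (n * n ^ (2 * d))    ≡⟨ cong (λ y → n ^ (3 * suc s) * (n * y)) (^-*-assoc n 2 d) ⟨
    n ^ (3 * suc s) * (n * (n ^ 2) ^ d)    ∎
    where
    arith : ∀ s d → s + 2 * suc (suc s + d) ≡ 3 * suc s + suc (2 * d)
    arith = solve-∀
... | inj₂ d≤s = begin
  (n C suc d) * (x * b ^ e) * n ^ (2 * suc n)
    ≤⟨ power-combine n b (suc d) (3 * suc d) e x (suc d * suc s) (C≤^ n (suc d)) exponents decayed ⟩
  b ^ (e + suc d * suc s) * (n ^ 2) ^ suc s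
    ≤⟨ *-monoʳ-≤ (b ^ (e + suc d * suc s)) (m≤n+m ((n ^ 2) ^ suc s) (n * (n ^ 2) ^ d)) ⟩
  b ^ (e + suc d * suc s) * (n * (n ^ 2) ^ d + (n ^ 2) ^ suc s) ∎
  where
  open ≤-Reasoning
  x = a ^ (suc d * suc s)
  3p≤1+s : 3 * p ≤ suc s
  3p≤1+s = *-cancelˡ-≤ 2 (begin
    2 * (3 * p)      ≡⟨ *-assoc 2 3 p ⟨
    6 * p            ≤⟨ 6p≤n ⟩
    n                ≡⟨ s+d≡n ⟨
    suc s + d        ≤⟨ +-monoʳ-≤ (suc s) (m≤n⇒m≤1+n d≤s) ⟩
    suc s + suc s    ≡⟨ cong (suc s +_) (+-identityʳ (suc s)) ⟨
    2 * suc s        ∎)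
  decayed : n ^ (3 * suc d) * x ≤ b ^ (suc d * suc s)
  decayed = subst (λ q → n ^ (3 * suc d) * a ^ q ≤ b ^ q) (*-comm (suc s) (suc d))
                  (decay-power n p a≤b decay 3p≤1+s (suc d))
  exponents : n ^ suc d * n ^ (2 * suc n) ≡ n ^ (3 * suc d) * (n ^ 2) ^ suc s
  exponents = begin-equality
    n ^ suc d * n ^ (2 * suc n)            ≡⟨ ^-distribˡ-+-* n (suc d) (2 * suc n) ⟨
    n ^ (suc d + 2 * suc n)                ≡⟨ cong (λ y → n ^ (suc d + 2 * suc y)) s+d≡n ⟨
    n ^ (suc d + 2 * suc (suc s + d))      ≡⟨ cong (n ^_) (arith s d) ⟩
    n ^ (3 * suc d + 2 * suc s)            ≡⟨ ^-distribˡ-+-* n (3 * suc d) (2 * suc s) ⟩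
    n ^ (3 * suc d) * n ^ (2 * suc s)      ≡⟨ cong (n ^ (3 * suc d) *_) (^-*-assoc n 2 (suc s)) ⟨
    n ^ (3 * suc d) * (n ^ 2) ^ suc s      ∎
    where
    arith : ∀ s d → suc d + 2 * suc (suc s + d) ≡ 3 * suc d + 2 * suc s
    arith = solve-∀

-- Divided out, this is (1 + 1/n²)^i ≤ 1 + i/n. The induction step needs n + i ≤ n², which holds
-- because n + i ≤ 2n.
[1+n²]^i-bound : ∀ n i → 2 ≤ n → i ≤ n → (n ^ 2 + 1) ^ i * n ≤ (n ^ 2) ^ i * (n + i)
[1+n²]^i-bound n zero    2≤n _   = ≤-reflexive (cong (1 *_) (sym (+-identityʳ n)))
[1+n²]^i-bound n (suc i) 2≤n i<n = begin
  (q + 1) * (q + 1) ^ i * n       ≡⟨ *-assoc (q + 1) ((q + 1) ^ i) n ⟩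
  (q + 1) * ((q + 1) ^ i * n)     ≤⟨ *-monoʳ-≤ (q + 1) ([1+n²]^i-bound n i 2≤n (<⇒≤ i<n)) ⟩
  (q + 1) * (q ^ i * (n + i))     ≡⟨ lemma₁ q (q ^ i) (n + i) ⟩
  q ^ i * (q * (n + i) + (n + i)) ≤⟨ *-monoʳ-≤ (q ^ i) (+-monoʳ-≤ (q * (n + i)) n+i≤q) ⟩
  q ^ i * (q * (n + i) + q)       ≡⟨ lemma₂ q (q ^ i) n i ⟩
  q * q ^ i * (n + suc i)         ∎
  where
  open ≤-Reasoning
  q = n ^ 2
  n+i≤q : n + i ≤ q
  n+i≤q = begin
    n + i        ≤⟨ +-monoʳ-≤ n (<⇒≤ i<n) ⟩
    n + n        ≡⟨ cong (n +_) (+-identityʳ n) ⟨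
    2 * n        ≤⟨ *-monoˡ-≤ n 2≤n ⟩
    n * n        ≡⟨ cong (n *_) (*-identityʳ n) ⟨
    n ^ 2        ∎
  lemma₁ : ∀ q p x → (q + 1) * (p * x) ≡ p * (q * x + x)
  lemma₁ = solve-∀
  lemma₂ : ∀ q p n i → p * (q * (n + i) + q) ≡ q * p * (n + (1 + i))
  lemma₂ = solve-∀

[1+n²]^n-bound : ∀ n → 2 ≤ n → (n ^ 2 + 1) ^ n ≤ 2 * (n ^ 2) ^ n
[1+n²]^n-bound n 2≤n = *-cancelʳ-≤ _ _ n {{>-nonZero (≤-trans (s≤s z≤n) 2≤n)}} (begin
  (n ^ 2 + 1) ^ n * n     ≤⟨ [1+n²]^i-bound n n 2≤n ≤-refl ⟩
  (n ^ 2) ^ n * (n + n)   ≡⟨ lemma ((n ^ 2) ^ n) n ⟩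
  2 * (n ^ 2) ^ n * n     ∎)
  where
  open ≤-Reasoning
  lemma : ∀ p n → p * (n + n) ≡ 2 * p * n
  lemma = solve-∀

-- The closing estimate of the union bound. Since (1 + 1/n²)^n ≤ 2, it suffices that 2t(n+1) < n²,
-- and 6t(n+1) ≤ n(n+1) < 3n².
total-bound : ∀ n t → 2 ≤ n → 6 * t ≤ n → t * (suc n * (n ^ 2 + 1) ^ n) < n ^ (2 * suc n)
total-bound n t 2≤n 6t≤n = begin-strict
  t * (suc n * (n ^ 2 + 1) ^ n)        ≤⟨ *-monoʳ-≤ t (*-monoʳ-≤ (suc n) ([1+n²]^n-bound n 2≤n)) ⟩
  t * (suc n * (2 * (n ^ 2) ^ n))      ≡⟨ lemma t (suc n) ((n ^ 2) ^ n) ⟩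
  2 * t * suc n * (n ^ 2) ^ n          <⟨ *-monoˡ-< ((n ^ 2) ^ n) {{m^n≢0 (n ^ 2) n {{m^n≢0 n 2}}}} small ⟩
  (n ^ 2) ^ suc n                      ≡⟨ ^-*-assoc n 2 (suc n) ⟩
  n ^ (2 * suc n)                      ∎
  where
  open ≤-Reasoning
  instance
    n≢0 : NonZero n
    n≢0 = >-nonZero (≤-trans (s≤s z≤n) 2≤n)
  lemma : ∀ t m p → t * (m * (2 * p)) ≡ 2 * t * m * p
  lemma = solve-∀
  small : 2 * t * suc n < n ^ 2
  small = *-cancelˡ-< 3 _ _ (begin-strict
    3 * (2 * t * suc n)   ≡⟨ lemma₁ t (suc n) ⟩
    6 * t * suc n         ≤⟨ *-monoˡ-≤ (suc n) 6t≤n ⟩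
    n * suc n             <⟨ *-monoʳ-< n (s≤s (m<n+m n 0<n)) ⟩
    n * (suc (n + n))     ≤⟨ *-monoʳ-≤ n (+-monoˡ-≤ (n + n) (≤-trans (s≤s z≤n) 2≤n)) ⟩
    n * (n + (n + n))     ≡⟨ lemma₂ n ⟩
    3 * n ^ 2             ∎)
    where
    0<n : 0 < n
    0<n = ≤-trans (s≤s z≤n) 2≤n
    lemma₁ : ∀ t m → 3 * (2 * t * m) ≡ 6 * t * m
    lemma₁ = solve-∀
    lemma₂ : ∀ n → n * (n + (n + n)) ≡ 3 * (n * (n * 1))
    lemma₂ = solve-∀

-- Random colourings

∑-swap : ∀ (f : A → B → ℕ) xs ys → ∑ (λ x → ∑ (f x) ys) xs ≡ ∑ (λ y → ∑ (λ x → f x y) xs) ys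
∑-swap f []       ys = sym (trans (∑-const 0 ys) (*-zeroʳ (length ys)))
∑-swap f (x ∷ xs) ys = trans (cong (∑ (f x) ys +_) (∑-swap f xs ys))
                             (sym (∑-+ (f x) (λ y → ∑ (λ x → f x y) xs) ys))

-- The first-moment argument, which replaces a random choice by a search: a head of value at least W
-- can be discarded, and the tail still averages below W.
below-average : ∀ (f : A → ℕ) W xs → ∑ f xs < length xs * W → ∃ λ x → f x < W
below-average f W (x ∷ xs) lt with f x <? W
... | yes fx<W = x , fx<W
... | no  fx≮W = below-average f W xs
  (+-cancelˡ-< W _ _ (≤-<-trans (+-monoˡ-≤ (∑ f xs) (≮⇒≥ fx≮W)) lt))

length-vectors : ∀ (xs : List A) n → length (vectors xs n) ≡ length xs ^ n
length-vectors xs zero    = refl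
length-vectors xs (suc n) = begin
  length (vectors xs (suc n))                      ≡⟨ length≡∑ (vectors xs (suc n)) ⟩
  ∑ (λ _ → 1) (vectors xs (suc n))                 ≡⟨ ∑-cartesianProductWith (λ _ → 1) _∷_ xs (vectors xs n) ⟩
  ∑ (λ _ → ∑ (λ _ → 1) (vectors xs n)) xs          ≡⟨ ∑-const (∑ (λ _ → 1) (vectors xs n)) xs ⟩
  length xs * ∑ (λ _ → 1) (vectors xs n)           ≡⟨ cong (length xs *_) (length≡∑ (vectors xs n)) ⟨
  length xs * length (vectors xs n)                ≡⟨ cong (length xs *_) (length-vectors xs n) ⟩
  length xs ^ suc n                                ∎
  where
  open ≡-Reasoning
  length≡∑ : ∀ {a} {A : Set a} (xs : List A) → length xs ≡ ∑ (λ _ → 1) xs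
  length≡∑ xs = sym (trans (∑-const 1 xs) (*-identityʳ (length xs)))

∑-allFin-≟ : ∀ t (c : Fin (suc t)) (f : Bool → ℕ) →
  ∑ (λ i → f (does (i ≟ c))) (allFin (suc t)) ≡ f true + t * f false
∑-allFin-≟ t c f = trans (cong (f (does (zero ≟ c)) +_) (trans
  (cong (∑ (λ i → f (does (i ≟ c)))) (sym (map-tabulate {n = t} id suc)))
  (∑-map (λ i → f (does (i ≟ c))) suc (allFin t)))) (go t c)
  where
  go : ∀ t (c : Fin (suc t)) →
       f (does (zero ≟ c)) + ∑ (λ i → f (does (suc i ≟ c))) (allFin t) ≡ f true + t * f false
  go t       zero    = cong (f true +_) (trans (∑-const (f false) (allFin t))
                         (cong (_* f false) (length-tabulate {n = t} id)))
  go (suc t) (suc c) = trans (cong (f false +_) (∑-allFin-≟ t c f)) (lemma (f false) (f true) (t * f false))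
    where
    lemma : ∀ x y z → x + (y + z) ≡ y + (x + z)
    lemma = solve-∀

class : ∀ {t m} → Fin t → Vec (Fin t) m → Subset m
class c = Vec.map (λ i → does (i ≟ c))

∈-class⁻ : ∀ {t m} (c : Fin t) (χ : Vec (Fin t) m) {x} → x ∈ class c χ → lookup χ x ≡ c
∈-class⁻ c χ {x} x∈ with lookup χ x ≟ c | trans (sym (lookup-map x (λ i → does (i ≟ c)) χ)) ([]=⇒lookup x∈)
... | yes eq | _  = eq
... | no _   | ()

missed : ∀ {t m} → Fin t → Vec (Fin t) m → Subset m → ℕ
missed c χ X = ∣ X ∩ ∁ (class c χ) ∣

-- t^m E[C(Z,d)] for a binomial variable Z counting the elements of X that avoid one of
-- t = 1 + t′ colours; the factor t^d clears the denominator of (1 - 1/t)^d.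
∑-missed-binomial : ∀ t {m} (c : Fin (suc t)) (X : Subset m) d →
  suc t ^ d * ∑ (λ χ → missed c χ X C d) (vectors (allFin (suc t)) m)
    ≡ (∣ X ∣ C d) * (t ^ d * suc t ^ m)
∑-missed-binomial t c [] zero    = refl
∑-missed-binomial t c [] (suc d) = *-zeroʳ (suc t ^ suc d)
∑-missed-binomial t {suc m} c (outside ∷ X) d = begin
  T ^ d * ∑ (λ χ → missed c χ (outside ∷ X) C d) (vectors (allFin T) (suc m))
    ≡⟨ cong (T ^ d *_) (∑-cartesianProductWith (λ χ → missed c χ (outside ∷ X) C d) _∷_ (allFin T) (vectors (allFin T) m)) ⟩
  T ^ d * ∑ (λ _ → s) (allFin T)
    ≡⟨ cong (T ^ d *_) (trans (∑-const s (allFin T)) (cong (_* s) (length-tabulate {n = T} id))) ⟩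
  T ^ d * (T * s)
    ≡⟨ swap-middle (T ^ d) T s ⟩
  T * (T ^ d * s)
    ≡⟨ cong (T *_) (∑-missed-binomial t c X d) ⟩
  T * ((∣ X ∣ C d) * (t ^ d * T ^ m))
    ≡⟨ lemma T (∣ X ∣ C d) (t ^ d) (T ^ m) ⟩
  (∣ X ∣ C d) * (t ^ d * (T * T ^ m)) ∎
  where
  open ≡-Reasoning
  T = suc t
  s = ∑ (λ χ → missed c χ X C d) (vectors (allFin T) m)
  lemma : ∀ a b c d → a * (b * (c * d)) ≡ b * (c * (a * d))
  lemma = solve-∀
∑-missed-binomial t {suc m} c (inside ∷ X) d = begin
  T ^ d * ∑ (λ χ → missed c χ (inside ∷ X) C d) (vectors (allFin T) (suc m))
    ≡⟨ cong (T ^ d *_) (∑-cartesianProductWith (λ χ → missed c χ (inside ∷ X) C d) _∷_ (allFin T) χs) ⟩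
  T ^ d * ∑ (λ i → ∑ (λ χ → missed c (i ∷ χ) (inside ∷ X) C d) χs) (allFin T)
    -- The first colour i matters only through whether it equals c.
    ≡⟨ cong (T ^ d *_) (∑-cong (λ i → split (does (i ≟ c))) (allFin T)) ⟩
  T ^ d * ∑ (λ i → g d (does (i ≟ c))) (allFin T)
    ≡⟨ cong (T ^ d *_) (∑-allFin-≟ t c (g d)) ⟩
  T ^ d * (g d true + t * g d false)
    ≡⟨ count d ⟩
  (suc ∣ X ∣ C d) * (t ^ d * (T * T ^ m)) ∎
  where
  open ≡-Reasoning
  T = suc t
  χs = vectors (allFin T) m
  s : ℕ → ℕ
  s d = ∑ (λ χ → missed c χ X C d) χs
  g : ℕ → Bool → ℕ
  g d true  = s d
  g d false = ∑ (λ χ → suc (missed c χ X) C d) χs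
  split : ∀ b → ∑ (λ χ → ∣ (inside ∷ X) ∩ ∁ (b ∷ class c χ) ∣ C d) χs ≡ g d b
  split true  = refl
  split false = refl
  count : ∀ d → T ^ d * (g d true + t * g d false) ≡ (suc ∣ X ∣ C d) * (t ^ d * (T * T ^ m))
  count zero = begin
    1 * (s 0 + t * s 0)            ≡⟨ lemma t (s 0) ⟩
    T * (T ^ 0 * s 0)              ≡⟨ cong (T *_) (∑-missed-binomial t c X 0) ⟩
    T * (1 * (1 * T ^ m))          ≡⟨ lemma′ T (T ^ m) ⟩
    1 * (1 * (T * T ^ m))          ∎
    where
    lemma : ∀ t s → 1 * (s + t * s) ≡ (1 + t) * (1 * s)
    lemma = solve-∀
    lemma′ : ∀ a b → a * (1 * (1 * b)) ≡ 1 * (1 * (a * b))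
    lemma′ = solve-∀
  -- In t of the T cases the new element is missed and Z becomes Z + 1. Pascal's rule splits
  -- C(Z+1,d+1), so the recursion is used at d + 1 and at d.
  count (suc d) = begin
    T * T ^ d * (s (suc d) + t * g (suc d) false)
      ≡⟨ cong (λ x → T * T ^ d * (s (suc d) + t * x)) pascal ⟩
    T * T ^ d * (s (suc d) + t * (s d + s (suc d)))
      ≡⟨ lemma t (T ^ d) (s (suc d)) (s d) ⟩
    T * (T * T ^ d * s (suc d)) + t * T * (T ^ d * s d)
      ≡⟨ cong₂ (λ x y → T * x + t * T * y) (∑-missed-binomial t c X (suc d)) (∑-missed-binomial t c X d) ⟩
    T * ((∣ X ∣ C suc d) * (t * t ^ d * T ^ m)) + t * T * ((∣ X ∣ C d) * (t ^ d * T ^ m))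
      ≡⟨ lemma′ T (∣ X ∣ C suc d) t (t ^ d) (T ^ m) (∣ X ∣ C d) ⟩
    ((∣ X ∣ C d) + (∣ X ∣ C suc d)) * (t * t ^ d * (T * T ^ m))
      ≡⟨ cong (_* (t * t ^ d * (T * T ^ m))) (nCk+nC[k+1]≡[n+1]C[k+1] ∣ X ∣ d) ⟩
    (suc ∣ X ∣ C suc d) * (t * t ^ d * (T * T ^ m)) ∎
    where
    pascal : g (suc d) false ≡ s d + s (suc d)
    pascal = trans (∑-cong (λ χ → sym (nCk+nC[k+1]≡[n+1]C[k+1] (missed c χ X) d)) χs)
                   (∑-+ (λ χ → missed c χ X C d) (λ χ → missed c χ X C suc d) χs)
    lemma : ∀ t p x y → (1 + t) * p * (x + t * (y + x)) ≡ (1 + t) * ((1 + t) * p * x) + t * (1 + t) * (p * y)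
    lemma = solve-∀
    lemma′ : ∀ T x t p q y → T * (x * (t * p * q)) + t * T * (y * (p * q)) ≡ (y + x) * (t * p * (T * q))
    lemma′ = solve-∀

-- Cardinalities of subsets and augmentation

∣p∪q∣+∣p∩q∣≡∣p∣+∣q∣ : ∀ {m} (p q : Subset m) → ∣ p ∪ q ∣ + ∣ p ∩ q ∣ ≡ ∣ p ∣ + ∣ q ∣
∣p∪q∣+∣p∩q∣≡∣p∣+∣q∣ []            []            = refl
∣p∪q∣+∣p∩q∣≡∣p∣+∣q∣ (outside ∷ p) (outside ∷ q) = ∣p∪q∣+∣p∩q∣≡∣p∣+∣q∣ p q
∣p∪q∣+∣p∩q∣≡∣p∣+∣q∣ (inside  ∷ p) (outside ∷ q) = cong suc (∣p∪q∣+∣p∩q∣≡∣p∣+∣q∣ p q)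
∣p∪q∣+∣p∩q∣≡∣p∣+∣q∣ (outside ∷ p) (inside  ∷ q) =
  trans (cong suc (∣p∪q∣+∣p∩q∣≡∣p∣+∣q∣ p q)) (sym (+-suc ∣ p ∣ ∣ q ∣))
∣p∪q∣+∣p∩q∣≡∣p∣+∣q∣ (inside  ∷ p) (inside  ∷ q) =
  cong suc (trans (+-suc ∣ p ∪ q ∣ ∣ p ∩ q ∣)
                  (trans (cong suc (∣p∪q∣+∣p∩q∣≡∣p∣+∣q∣ p q)) (sym (+-suc ∣ p ∣ ∣ q ∣))))

∣p∩q∣+∣p∩∁q∣≡∣p∣ : ∀ {m} (p q : Subset m) → ∣ p ∩ q ∣ + ∣ p ∩ ∁ q ∣ ≡ ∣ p ∣
∣p∩q∣+∣p∩∁q∣≡∣p∣ []            []            = refl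
∣p∩q∣+∣p∩∁q∣≡∣p∣ (outside ∷ p) (_       ∷ q) = ∣p∩q∣+∣p∩∁q∣≡∣p∣ p q
∣p∩q∣+∣p∩∁q∣≡∣p∣ (inside  ∷ p) (inside  ∷ q) = cong suc (∣p∩q∣+∣p∩∁q∣≡∣p∣ p q)
∣p∩q∣+∣p∩∁q∣≡∣p∣ (inside  ∷ p) (outside ∷ q) =
  trans (+-suc ∣ p ∩ q ∣ ∣ p ∩ ∁ q ∣) (cong suc (∣p∩q∣+∣p∩∁q∣≡∣p∣ p q))

∣∪∣-disjoint : ∀ {m} {p q : Subset m} → Disjoint p q → ∣ p ∪ q ∣ ≡ ∣ p ∣ + ∣ q ∣
∣∪∣-disjoint {m} {p} {q} disj = begin
  ∣ p ∪ q ∣              ≡⟨ +-identityʳ ∣ p ∪ q ∣ ⟨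
  ∣ p ∪ q ∣ + 0          ≡⟨ cong (∣ p ∪ q ∣ +_) (trans (cong ∣_∣ empty) (∣⊥∣≡0 m)) ⟨
  ∣ p ∪ q ∣ + ∣ p ∩ q ∣  ≡⟨ ∣p∪q∣+∣p∩q∣≡∣p∣+∣q∣ p q ⟩
  ∣ p ∣ + ∣ q ∣          ∎
  where
  open ≡-Reasoning
  empty : p ∩ q ≡ ⊥
  empty = Empty-unique λ (x , x∈) → let x∈p , x∈q = x∈p∩q⁻ p q x∈ in disj x x∈p x∈q

-- Iterated exchange. The added elements are returned as a separate set X because only they are
-- tested for their colour afterwards.
augment : ∀ {m} (M : Matroid m) {A B} j → Indep M A → Indep M B → ∣ A ∣ + j ≤ ∣ B ∣ →
          ∃ λ X → X ⊆ B × Disjoint X A × Indep M (X ∪ A) × ∣ X ∣ ≡ j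
augment {m} M {A} zero    IA IB _  =
  ⊥ , ⊆-min _ , (λ _ x∈⊥ _ → ∉⊥ x∈⊥) , subst (Indep M) (sym (∪-identityˡ A)) IA , ∣⊥∣≡0 m
augment M {A} {B} (suc j) IA IB le
  with X , X⊆B , X#A , IX , ∣X∣≡j ← augment M j IA IB (≤-trans (+-monoʳ-≤ ∣ A ∣ (n≤1+n j)) le)
  with x , x∈B , x∉X∪A , Ix ← indep-exch M IX IB (subst (λ k → suc k ≤ ∣ B ∣)
         (trans (+-comm ∣ A ∣ j) (trans (cong (_+ ∣ A ∣) (sym ∣X∣≡j)) (sym (∣∪∣-disjoint X#A))))
         (subst (_≤ ∣ B ∣) (+-suc ∣ A ∣ j) le))
  = ⁅ x ⁆ ∪ X , sub , disj , subst (Indep M) (sym (∪-assoc ⁅ x ⁆ X A)) Ix , card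
  where
  sub : ⁅ x ⁆ ∪ X ⊆ B
  sub y∈ with x∈p∪q⁻ ⁅ x ⁆ X y∈
  ... | inj₁ y∈x rewrite x∈⁅y⁆⇒x≡y x y∈x = x∈B
  ... | inj₂ y∈X = X⊆B y∈X
  disj : Disjoint (⁅ x ⁆ ∪ X) A
  disj y y∈ y∈A with x∈p∪q⁻ ⁅ x ⁆ X y∈
  ... | inj₁ y∈x rewrite x∈⁅y⁆⇒x≡y x y∈x = x∉X∪A (q⊆p∪q X A y∈A)
  ... | inj₂ y∈X = X#A y y∈X y∈A
  x#X : Disjoint ⁅ x ⁆ X
  x#X y y∈x y∈X rewrite x∈⁅y⁆⇒x≡y x y∈x = x∉X∪A (p⊆p∪q A y∈X)
  card : ∣ ⁅ x ⁆ ∪ X ∣ ≡ suc j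
  card = trans (∣∪∣-disjoint x#X) (cong₂ _+_ (∣⁅x⁆∣≡1 x) ∣X∣≡j)

1≤nCk : ∀ {n k} → k ≤ n → 1 ≤ n C k
1≤nCk {n}     {zero}  _         = ≤-refl
1≤nCk {suc n} {suc k} (s≤s k≤n) = ≤-trans (1≤nCk k≤n)
  (subst (n C k ≤_) (nCk+nC[k+1]≡[n+1]C[k+1] n k) (m≤m+n (n C k) (n C suc k)))

-- Exposing the bases one at a time

module Exposure {m} (M : Matroid m) (n t K : ℕ) where

  -- Each basis receives its own colouring of the whole ground set, of which only the values on that
  -- basis are used.
  Colouring : Set
  Colouring = Vec (Fin (suc t)) m

  colourings : List Colouring
  colourings = vectors (allFin (suc t)) m

  length-colourings : length colourings ≡ suc t ^ m
  length-colourings = trans (length-vectors (allFin (suc t)) m) (cong (_^ m) (length-tabulate {n = suc t} id))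

  -- A pair (colour, J) whose elements are being exposed basis by basis: I is the independent
  -- set found so far, J marks which of the r bases still to come belong to J, and the test
  -- fails if d elements stay missing from I at the end.
  record Test (r : ℕ) : Set where
    constructor test
    field
      colour  : Fin (suc t)
      d e u   : ℕ
      J       : Subset r
      I       : Subset m
      indep   : Indep M I
      size    : ∣ I ∣ + u ≡ n
      balance : e + d * ∣ J ∣ ≡ K

  open Test

  -- (1+t)^K times the expected number of d-sets of missing elements.
  weight : ∀ {r} → Test r → ℕ
  weight T = (u T C d T) * (t ^ (d T * ∣ J T ∣) * suc t ^ e T)

  -- For d = n + 1 - |J| the inequality amounts to |J| ≤ |I′|.
  Passes : ∀ {r} → (Fin r → Subset m) → (Fin r → Colouring) → Test r → Set
  Passes B χ T = ∃ λ I′ → Indep M I′ × n < ∣ I′ ∣ + d T ×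
    (∀ {x} → x ∈ I′ → x ∈ I T ⊎ ∃ λ j → j ∈ J T × x ∈ B j × lookup (χ j) x ≡ colour T)

  module _ {B₀ : Subset m} (IB₀ : Indep M B₀) (∣B₀∣≡n : ∣ B₀ ∣ ≡ n) where

    -- X depends on the test but not on the colouring of `B₀`, so the number of its elements that
    -- miss the colour is binomially distributed.
    module Extend {r} (T : Test (suc r)) where
      extension : ∃ λ X → X ⊆ B₀ × Disjoint X (I T) × Indep M (X ∪ I T) × ∣ X ∣ ≡ u T
      extension = augment M (u T) (indep T) IB₀ (≤-reflexive (trans (size T) (sym ∣B₀∣≡n)))

      X : Subset m
      X = proj₁ extension

    -- A basis outside J changes nothing. For a basis in J, the elements of X in the tested colour
    -- join I, and the rest of X is what is missing from now on.
    expose : ∀ {r} → Test (suc r) → Colouring → Test r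
    expose T@(test _ _ _ _ (outside ∷ J′) _ _ _ _) χ = record
      { colour = colour T ; d = d T ; e = e T ; u = u T ; J = J′ ; I = I T
      ; indep = indep T ; size = size T
      ; balance = balance T }
    expose T@(test _ _ _ _ (inside ∷ J′) _ _ _ _) χ = record
      -- Each pending basis of J accounts for d of the K factors; exposing one moves them into e.
      { colour = colour T ; d = d T ; e = e T + d T ; u = missed (colour T) χ X ; J = J′
      ; I = (X ∩ class (colour T) χ) ∪ I T
      ; indep = indep-⊆ M sub (proj₁ (proj₂ (proj₂ (proj₂ extension))))
      ; size = size′
      ; balance = trans (trans (+-assoc (e T) (d T) (d T * ∣ J′ ∣)) (cong (e T +_) (sym (*-suc (d T) ∣ J′ ∣))))
                        (balance T) }
      where
      open Extend T
      Y : Subset m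
      Y = X ∩ class (colour T) χ
      sub : Y ∪ I T ⊆ X ∪ I T
      sub x∈ with x∈p∪q⁻ Y (I T) x∈
      ... | inj₁ x∈Y = p⊆p∪q (I T) (p∩q⊆p X _ x∈Y)
      ... | inj₂ x∈I = q⊆p∪q X (I T) x∈I
      size′ : ∣ Y ∪ I T ∣ + missed (colour T) χ X ≡ n
      size′ = begin
        ∣ Y ∪ I T ∣ + missed (colour T) χ X
          ≡⟨ cong (_+ missed (colour T) χ X) (∣∪∣-disjoint λ x x∈Y → proj₁ (proj₂ (proj₂ extension)) x (p∩q⊆p X _ x∈Y)) ⟩
        ∣ Y ∣ + ∣ I T ∣ + missed (colour T) χ X
          ≡⟨ lemma ∣ Y ∣ ∣ I T ∣ (missed (colour T) χ X) ⟩
        ∣ I T ∣ + (∣ Y ∣ + missed (colour T) χ X)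
          ≡⟨ cong (∣ I T ∣ +_) (trans (∣p∩q∣+∣p∩∁q∣≡∣p∣ X _) (proj₂ (proj₂ (proj₂ (proj₂ extension))))) ⟩
        ∣ I T ∣ + u T
          ≡⟨ size T ⟩
        n ∎
        where
        open ≡-Reasoning
        lemma : ∀ a b c → a + b + c ≡ b + (a + c)
        lemma = solve-∀

    -- The weight is a martingale: averaged over the (1+t)^m colourings of `B₀` it does not change.
    -- For a basis in J this is `∑-missed-binomial` applied to X, which has u elements.
    ∑-weight-expose : ∀ {r} (T : Test (suc r)) → ∑ (weight ∘ expose T) colourings ≡ suc t ^ m * weight T
    ∑-weight-expose T@(test _ _ _ _ (outside ∷ J′) _ _ _ _) = trans (∑-const w colourings) (cong (_* w) length-colourings)
      where w = (u T C d T) * (t ^ (d T * ∣ J′ ∣) * suc t ^ e T)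
    ∑-weight-expose T@(test _ _ _ _ (inside ∷ J′) _ _ _ _) = begin
      ∑ (λ χ → (missed (colour T) χ X C d T) * (p * q)) colourings
        ≡⟨ ∑-cong (λ χ → *-comm (missed (colour T) χ X C d T) (p * q)) colourings ⟩
      ∑ (λ χ → p * q * (missed (colour T) χ X C d T)) colourings
        ≡⟨ ∑-*ˡ (p * q) (λ χ → missed (colour T) χ X C d T) colourings ⟩
      p * q * s
        ≡⟨ cong (λ q → p * q * s) (^-distribˡ-+-* (suc t) (e T) (d T)) ⟩
      p * (suc t ^ e T * suc t ^ d T) * s
        ≡⟨ lemma p (suc t ^ e T) (suc t ^ d T) s ⟩
      p * suc t ^ e T * (suc t ^ d T * s)
        ≡⟨ cong (p * suc t ^ e T *_) (∑-missed-binomial t (colour T) X (d T)) ⟩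
      p * suc t ^ e T * ((∣ X ∣ C d T) * (t ^ d T * suc t ^ m))
        ≡⟨ lemma′ p (suc t ^ e T) (∣ X ∣ C d T) (t ^ d T) (suc t ^ m) ⟩
      suc t ^ m * ((∣ X ∣ C d T) * (t ^ d T * p * suc t ^ e T))
        ≡⟨ cong₂ (λ u p → suc t ^ m * ((u C d T) * (p * suc t ^ e T)))
             (proj₂ (proj₂ (proj₂ (proj₂ extension))))
             (trans (sym (^-distribˡ-+-* t (d T) (d T * ∣ J′ ∣))) (cong (t ^_) (sym (*-suc (d T) ∣ J′ ∣)))) ⟩
      suc t ^ m * ((u T C d T) * (t ^ (d T * suc ∣ J′ ∣) * suc t ^ e T)) ∎
      where
      open ≡-Reasoning
      open Extend T
      p = t ^ (d T * ∣ J′ ∣)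
      q = suc t ^ (e T + d T)
      s = ∑ (λ χ → missed (colour T) χ X C d T) colourings
      lemma : ∀ p a b s → p * (a * b) * s ≡ p * a * (b * s)
      lemma = solve-∀
      lemma′ : ∀ p a c b m → p * a * (c * (b * m)) ≡ m * (c * (b * p * a))
      lemma′ = solve-∀

    Passes-expose : ∀ {r} {B : Fin (suc r) → Subset m} {χ} (T : Test (suc r)) → B zero ≡ B₀ →
      Passes (B ∘ suc) (χ ∘ suc) (expose T (χ zero)) → Passes B χ T
    Passes-expose {B = B} {χ} T@(test _ _ _ _ (outside ∷ J′) _ _ _ _) refl (I′ , II′ , n< , ∈I′) = I′ , II′ , n< , λ x∈ → lift (∈I′ x∈)
      where
      lift : ∀ {x} → x ∈ I T ⊎ (∃ λ j → j ∈ J′ × x ∈ B (suc j) × lookup (χ (suc j)) x ≡ colour T) →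
             x ∈ I T ⊎ (∃ λ j → j ∈ outside ∷ J′ × x ∈ B j × lookup (χ j) x ≡ colour T)
      lift (inj₁ x∈I)                  = inj₁ x∈I
      lift (inj₂ (j , j∈ , x∈B , col)) = inj₂ (suc j , there j∈ , x∈B , col)
    Passes-expose {B = B} {χ} T@(test _ _ _ _ (inside ∷ J′) _ _ _ _) refl (I′ , II′ , n< , ∈I′) = I′ , II′ , n< , λ x∈ → lift (∈I′ x∈)
      where
      open Extend T
      Y : Subset m
      Y = X ∩ class (colour T) (χ zero)
      lift : ∀ {x} → x ∈ Y ∪ I T ⊎ (∃ λ j → j ∈ J′ × x ∈ B (suc j) × lookup (χ (suc j)) x ≡ colour T) →
             x ∈ I T ⊎ (∃ λ j → j ∈ inside ∷ J′ × x ∈ B j × lookup (χ j) x ≡ colour T)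
      lift (inj₂ (j , j∈ , x∈B , col)) = inj₂ (suc j , there j∈ , x∈B , col)
      lift (inj₁ x∈) with x∈p∪q⁻ Y (I T) x∈
      ... | inj₂ x∈I = inj₁ x∈I
      ... | inj₁ x∈Y with x∈X , x∈c ← x∈p∩q⁻ X _ x∈Y =
        inj₂ (zero , here , proj₁ (proj₂ extension) x∈X , ∈-class⁻ (colour T) (χ zero) x∈c)

  -- With no basis pending, e = K and the weight is C(u,d) (1+t)^K. Being below (1+t)^K forces
  -- C(u,d) = 0, that is u < d.
  weight<⇒Passes : (B : Fin 0 → Subset m) (χ : Fin 0 → Colouring) (T : Test 0) →
                   weight T < suc t ^ K → Passes B χ T
  weight<⇒Passes B χ T@(test _ _ _ _ [] _ _ _ _) w< = I T , indep T ,
    subst (_< ∣ I T ∣ + d T) (size T) (+-monoʳ-< ∣ I T ∣ (≰⇒> λ d≤u → <⇒≱ w< (heavy d≤u))) , inj₁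
    where
    open ≤-Reasoning
    e≡K : e T ≡ K
    e≡K = trans (sym (trans (cong (e T +_) (*-zeroʳ (d T))) (+-identityʳ (e T)))) (balance T)
    heavy : d T ≤ u T → suc t ^ K ≤ weight T
    heavy d≤u = begin
      suc t ^ K                                    ≡⟨ cong (suc t ^_) e≡K ⟨
      suc t ^ e T                                  ≡⟨ lemma (suc t ^ e T) ⟩
      1 * (1 * suc t ^ e T)                        ≤⟨ *-monoˡ-≤ (1 * suc t ^ e T) (1≤nCk d≤u) ⟩
      (u T C d T) * (1 * suc t ^ e T)              ≡⟨ cong (λ k → (u T C d T) * (t ^ k * suc t ^ e T)) (*-zeroʳ (d T)) ⟨
      (u T C d T) * (t ^ (d T * 0) * suc t ^ e T)  ∎
      where
      lemma : ∀ x → x ≡ 1 * (1 * x)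
      lemma = solve-∀

  -- Conditional expectations: exposing a basis preserves the total weight on average, so some
  -- colouring of the first basis keeps it below (1+t)^K. At the end each single weight is below
  -- that bound too.
  all-pass : ∀ r (B : Fin r → Subset m) → (∀ j → Indep M (B j)) → (∀ j → ∣ B j ∣ ≡ n) →
             (Ts : List (Test r)) → ∑ weight Ts < suc t ^ K →
             ∃ λ χ → All (Passes B χ) Ts
  all-pass zero B IB ∣B∣ Ts w< = (λ ()) , go Ts w<
    where
    go : ∀ Ts → ∑ weight Ts < suc t ^ K → All (Passes B (λ ())) Ts
    go []       _  = []
    go (T ∷ Ts) w< = weight<⇒Passes B (λ ()) T (≤-<-trans (m≤m+n (weight T) (∑ weight Ts)) w<) ∷
                     go Ts (≤-<-trans (m≤n+m (∑ weight Ts) (weight T)) w<)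
  all-pass (suc r) B IB ∣B∣ Ts w< =
    χ , All.map (λ {T} → Passes-expose (IB zero) (∣B∣ zero) {B = B} {χ} T refl) (All.map⁻ (proj₂ rest))
    where
    next : Test (suc r) → Colouring → Test r
    next = expose (IB zero) (∣B∣ zero)
    open ≤-Reasoning
    total : ∑ (λ χ → ∑ (λ T → weight (next T χ)) Ts) colourings < length colourings * suc t ^ K
    total = begin-strict
      ∑ (λ χ → ∑ (λ T → weight (next T χ)) Ts) colourings  ≡⟨ ∑-swap (λ χ T → weight (next T χ)) colourings Ts ⟩
      ∑ (λ T → ∑ (weight ∘ next T) colourings) Ts          ≡⟨ ∑-cong (∑-weight-expose (IB zero) (∣B∣ zero)) Ts ⟩
      ∑ (λ T → suc t ^ m * weight T) Ts                    ≡⟨ ∑-*ˡ (suc t ^ m) weight Ts ⟩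
      suc t ^ m * ∑ weight Ts                              <⟨ *-monoʳ-< (suc t ^ m) {{m^n≢0 (suc t) m}} w< ⟩
      suc t ^ m * suc t ^ K                                ≡⟨ cong (_* suc t ^ K) length-colourings ⟨
      length colourings * suc t ^ K                        ∎
    lighter : ∃ λ χ₀ → ∑ (λ T → weight (next T χ₀)) Ts < suc t ^ K
    lighter = below-average (λ χ → ∑ (λ T → weight (next T χ)) Ts) (suc t ^ K) colourings total
    χ₀ : Colouring
    χ₀ = proj₁ lighter
    rest : ∃ λ χ → All (Passes (B ∘ suc) χ) (map (λ T → next T χ₀) Ts)
    rest = all-pass r (B ∘ suc) (IB ∘ suc) (∣B∣ ∘ suc) (map (λ T → next T χ₀) Ts)
      (subst (_< suc t ^ K) (sym (∑-map weight (λ T → next T χ₀) Ts)) (proj₂ lighter))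
    χ : Fin (suc r) → Colouring
    χ zero    = χ₀
    χ (suc j) = proj₁ rest j

-- Rado's theorem for the sets X ∩ B j

∣p∪q∣≤∣p∣+∣q∣ : ∀ {m} (p q : Subset m) → ∣ p ∪ q ∣ ≤ ∣ p ∣ + ∣ q ∣
∣p∪q∣≤∣p∣+∣q∣ p q = subst (∣ p ∪ q ∣ ≤_) (∣p∪q∣+∣p∩q∣≡∣p∣+∣q∣ p q) (m≤m+n ∣ p ∪ q ∣ ∣ p ∩ q ∣)

∣p∣≤1+∣p-x∣ : ∀ {m} (p : Subset m) x → ∣ p ∣ ≤ suc ∣ p - x ∣
∣p∣≤1+∣p-x∣ p x = begin
  ∣ p ∣                    ≤⟨ p⊆q⇒∣p∣≤∣q∣ cover ⟩
  ∣ ⁅ x ⁆ ∪ (p - x) ∣      ≤⟨ ∣p∪q∣≤∣p∣+∣q∣ ⁅ x ⁆ (p - x) ⟩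
  ∣ ⁅ x ⁆ ∣ + ∣ p - x ∣    ≡⟨ cong (_+ ∣ p - x ∣) (∣⁅x⁆∣≡1 x) ⟩
  suc ∣ p - x ∣            ∎
  where
  open ≤-Reasoning
  cover : p ⊆ ⁅ x ⁆ ∪ (p - x)
  cover {y} y∈p with y ≟ x
  ... | yes refl = p⊆p∪q (p - x) (x∈⁅x⁆ x)
  ... | no y≢x   = q⊆p∪q ⁅ x ⁆ (p - x) (x∈p∧x≢y⇒x∈p-y y∈p y≢x)

0<∣p∣⇒nonempty : ∀ {m} (p : Subset m) → 0 < ∣ p ∣ → ∃ λ x → x ∈ p
0<∣p∣⇒nonempty (inside  ∷ p) _  = zero , here
0<∣p∣⇒nonempty (outside ∷ p) lt with x , x∈p ← 0<∣p∣⇒nonempty p lt = suc x , there x∈p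

1<∣p∣⇒two : ∀ {m} (p : Subset m) → 1 < ∣ p ∣ → ∃₂ λ x y → x ∈ p × y ∈ p × x ≢ y
1<∣p∣⇒two (inside  ∷ p) (s≤s lt) with x , x∈p ← 0<∣p∣⇒nonempty p lt =
  zero , suc x , here , there x∈p , λ ()
1<∣p∣⇒two (outside ∷ p) lt with x , y , x∈p , y∈p , x≢y ← 1<∣p∣⇒two p lt =
  suc x , suc y , there x∈p , there y∈p , x≢y ∘ suc-injective

x∈p-y⇒x∈p : ∀ {m} {p : Subset m} {x y} → x ∈ p - y → x ∈ p
x∈p-y⇒x∈p {p = p} {y = y} = p─q⊆p p ⁅ y ⁆

x∈p-y⇒x≢y : ∀ {m} {p : Subset m} {x y} → x ∈ p - y → x ≢ y
x∈p-y⇒x≢y {p = inside  ∷ p} {zero}  {suc y} _        = λ ()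
x∈p-y⇒x≢y {p = s ∷ p}       {suc x} {zero}  _        = λ ()
x∈p-y⇒x≢y {p = s ∷ p}       {suc x} {suc y} (there h) = x∈p-y⇒x≢y h ∘ suc-injective

union : ∀ {m r} → (Fin r → Subset m) → Subset r → Subset m
union B []            = ⊥
union B (outside ∷ J) = union (B ∘ suc) J
union B (inside  ∷ J) = B zero ∪ union (B ∘ suc) J

∈-union⁺ : ∀ {m r} {B : Fin r → Subset m} {J x} j → j ∈ J → x ∈ B j → x ∈ union B J
∈-union⁺ {J = inside  ∷ J} zero    here       x∈B = p⊆p∪q _ x∈B
∈-union⁺ {J = outside ∷ J} (suc j) (there j∈) x∈B = ∈-union⁺ j j∈ x∈B
∈-union⁺ {J = inside  ∷ J} (suc j) (there j∈) x∈B = q⊆p∪q _ _ (∈-union⁺ j j∈ x∈B)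

∈-union⁻ : ∀ {m r} (B : Fin r → Subset m) J {x} → x ∈ union B J → ∃ λ j → j ∈ J × x ∈ B j
∈-union⁻ B []            x∈ = contradiction x∈ ∉⊥
∈-union⁻ B (outside ∷ J) x∈ with j , j∈ , x∈B ← ∈-union⁻ (B ∘ suc) J x∈ = suc j , there j∈ , x∈B
∈-union⁻ B (inside  ∷ J) x∈ with x∈p∪q⁻ (B zero) (union (B ∘ suc) J) x∈
... | inj₁ x∈B₀ = zero , here , x∈B₀
... | inj₂ x∈U with j , j∈ , x∈B ← ∈-union⁻ (B ∘ suc) J x∈U = suc j , there j∈ , x∈B

∣∩∪∣≤ : ∀ {m} (T p q : Subset m) → ∣ T ∩ (p ∪ q) ∣ ≤ ∣ T ∩ p ∣ + ∣ T ∩ q ∣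
∣∩∪∣≤ T p q = subst (λ s → ∣ s ∣ ≤ ∣ T ∩ p ∣ + ∣ T ∩ q ∣) (sym (∩-distribˡ-∪ T p q)) (∣p∪q∣≤∣p∣+∣q∣ (T ∩ p) (T ∩ q))

∣T∩union∣≤ : ∀ {m} r (B : Fin r → Subset m) T → (∀ j → ∣ T ∩ B j ∣ ≤ 1) → ∣ T ∩ union B ⊤ ∣ ≤ r
∣T∩union∣≤ {m} zero    B T ≤1 = subst (∣ T ∩ ⊥ ∣ ≤_) (∣⊥∣≡0 m) (∣p∩q∣≤∣q∣ T ⊥)
∣T∩union∣≤ (suc r) B T ≤1 = ≤-trans (∣∩∪∣≤ T (B zero) (union (B ∘ suc) ⊤))
                                   (+-mono-≤ (≤1 zero) (∣T∩union∣≤ r (B ∘ suc) T (≤1 ∘ suc)))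

-- A missed set would leave r - 1 sets to account for r elements of T, each set supplying at most
-- one.
all-met-once : ∀ {m} r (B : Fin r → Subset m) T → (∀ j → ∣ T ∩ B j ∣ ≤ 1) →
               r ≤ ∣ T ∩ union B ⊤ ∣ → ∀ j → ∣ T ∩ B j ∣ ≡ 1
all-met-once (suc r) B T ≤1 r< = λ where
    zero    → ≤-antisym (≤1 zero) (+-cancelʳ-≤ r 1 ∣ T ∩ B zero ∣
                (≤-trans split (+-monoʳ-≤ ∣ T ∩ B zero ∣ (∣T∩union∣≤ r (B ∘ suc) T (≤1 ∘ suc)))))
    (suc j) → all-met-once r (B ∘ suc) T (≤1 ∘ suc)
                (s≤s⁻¹ (≤-trans split (+-monoˡ-≤ ∣ T ∩ union (B ∘ suc) ⊤ ∣ (≤1 zero)))) j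
  where
  split : suc r ≤ ∣ T ∩ B zero ∣ + ∣ T ∩ union (B ∘ suc) ⊤ ∣
  split = ≤-trans r< (∣∩∪∣≤ T (B zero) (union (B ∘ suc) ⊤))

-- A search through all subsets that stops at the first one yielding R; U itself need not be
-- decidable.
∀-⊎ : ∀ n {U : Subset n → Set} {R : Set} → (∀ J → U J ⊎ R) → (∀ J → U J) ⊎ R
∀-⊎ zero    f with f []
... | inj₁ p = inj₁ λ { [] → p }
... | inj₂ r = inj₂ r
∀-⊎ (suc n) f with ∀-⊎ n (f ∘ (outside ∷_)) | ∀-⊎ n (f ∘ (inside ∷_))
... | inj₂ r | _      = inj₂ r
... | inj₁ _ | inj₂ r = inj₂ r
... | inj₁ p | inj₁ q = inj₁ λ { (outside ∷ J) → p J ; (inside ∷ J) → q J }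

-- Turns a choice made for each pair into one uniform choice, by searching over K for each fixed J
-- and then over J.
∀∀-⊎ : ∀ n {U V : Subset n → Set} → (∀ J K → U J ⊎ V K) → (∀ J → U J) ⊎ (∀ K → V K)
∀∀-⊎ n f = ∀-⊎ n λ J → Sum.swap (∀-⊎ n λ K → Sum.swap (f J K))

module Rado {m n} (M : Matroid m) (B : Fin n → Subset m)
            (disj : ∀ i j → i ≢ j → Disjoint (B i) (B j)) where

  -- Rado's condition at J, with the rank bound carried by an explicit independent set.
  Rich : Subset m → Subset n → Set
  Rich X J = ∃ λ I → Indep M I × I ⊆ X ∩ union B J × ∣ J ∣ ≤ ∣ I ∣

  same-index : ∀ {i j x} → x ∈ B i → x ∈ B j → i ≡ j
  same-index {i} {j} {x} x∈i x∈j with i ≟ j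
  ... | yes eq = eq
  ... | no i≢j = contradiction x∈j (disj i j i≢j x x∈i)

  -- By disjointness x lies in no `B j` with j in J, so the old witness avoids x.
  Rich-delete : ∀ {X J i x} → x ∈ B i → i ∉ J → Rich X J → Rich (X - x) J
  Rich-delete {X} {J} {i} {x} x∈B i∉J (I , II , I⊆ , ∣J∣≤) = I , II , sub , ∣J∣≤
    where
    sub : I ⊆ (X - x) ∩ union B J
    sub {z} z∈I with z∈X , z∈U ← x∈p∩q⁻ X (union B J) (I⊆ z∈I) =
      x∈p∩q⁺ (x∈p∧x≢y⇒x∈p-y z∈X z≢x , z∈U)
      where
      z≢x : z ≢ x
      z≢x refl with j , j∈J , z∈B ← ∈-union⁻ B J z∈U = i∉J (subst (_∈ J) (same-index z∈B x∈B) j∈J)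

  -- Serves to nest a witness for an intersection inside one for a union, as the submodularity
  -- argument requires.
  grow : ∀ {I I′} → Indep M I → Indep M I′ →
         ∃ λ I″ → Indep M I″ × I ⊆ I″ × I″ ⊆ I ∪ I′ × ∣ I′ ∣ ≤ ∣ I″ ∣
  grow {I} {I′} II II′ with ≤-total ∣ I′ ∣ ∣ I ∣
  ... | inj₁ small = I , II , id , p⊆p∪q I′ , small
  ... | inj₂ large
    with X , X⊆I′ , X#I , IX , ∣X∣ ← augment M (∣ I′ ∣ ∸ ∣ I ∣) II II′ (≤-reflexive (m+[n∸m]≡n large))
    = X ∪ I , IX , q⊆p∪q X I , sub , ≤-reflexive (sym card)
    where
    sub : X ∪ I ⊆ I ∪ I′
    sub z∈ with x∈p∪q⁻ X I z∈
    ... | inj₁ z∈X = q⊆p∪q I I′ (X⊆I′ z∈X)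
    ... | inj₂ z∈I = p⊆p∪q I′ z∈I
    card : ∣ X ∪ I ∣ ≡ ∣ I′ ∣
    card = trans (∣∪∣-disjoint X#I) (trans (cong (_+ ∣ I ∣) ∣X∣) (m∸n+n≡m large))

  -- Deleting x spoils J and deleting y spoils K cannot both happen, by submodularity of the rank
  -- on (X - x) ∩ B(J) and (X - y) ∩ B(K).
  delete-one : ∀ {X i x y} → (∀ J → Rich X J) → x ∈ B i → y ∈ B i → x ≢ y →
               ∀ J K → Rich (X - x) J ⊎ Rich (X - y) K
  delete-one {X} {i} {x} {y} rich x∈B y∈B x≢y J K with i ∈? J | i ∈? K
  ... | no i∉J | _ = inj₁ (Rich-delete x∈B i∉J (rich J))
  ... | yes _ | no i∉K = inj₂ (Rich-delete y∈B i∉K (rich K))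
  ... | yes i∈J | yes i∈K
    -- Leaving out i keeps this witness clear of x and y, which both lie in `B i`, at the cost of
    -- one in cardinality.
    with I , II , I⊆ , ∣J∩K∣≤ ← rich ((J ∩ K) - i)
    with I′ , II′ , I′⊆ , ∣J∪K∣≤ ← rich (J ∪ K)
    with I″ , II″ , I⊆I″ , I″⊆ , ∣I′∣≤ ← grow II II′
    = pick
    where
    U V : Subset m
    U = (X - x) ∩ union B J
    V = (X - y) ∩ union B K
    -- Deleting x from X costs nothing in U ∪ V: x differs from y and i is in K, so x survives in V.
    in-J : ∀ {z j} → z ∈ X → j ∈ J → z ∈ B j → z ∈ U ⊎ z ∈ V
    in-J {z} {j} z∈X j∈J z∈B with z ≟ x
    ... | yes refl = inj₂ (x∈p∩q⁺ (x∈p∧x≢y⇒x∈p-y z∈X x≢y , ∈-union⁺ i i∈K x∈B))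
    ... | no z≢x   = inj₁ (x∈p∩q⁺ (x∈p∧x≢y⇒x∈p-y z∈X z≢x , ∈-union⁺ j j∈J z∈B))
    in-K : ∀ {z j} → z ∈ X → j ∈ K → z ∈ B j → z ∈ U ⊎ z ∈ V
    in-K {z} {j} z∈X j∈K z∈B with z ≟ y
    ... | yes refl = inj₁ (x∈p∩q⁺ (x∈p∧x≢y⇒x∈p-y z∈X (x≢y ∘ sym) , ∈-union⁺ i i∈J y∈B))
    ... | no z≢y   = inj₂ (x∈p∩q⁺ (x∈p∧x≢y⇒x∈p-y z∈X z≢y , ∈-union⁺ j j∈K z∈B))
    both : ∀ {z} → z ∈ I → z ∈ U × z ∈ V
    both {z} z∈I with z∈X , z∈U ← x∈p∩q⁻ X (union B ((J ∩ K) - i)) (I⊆ z∈I)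
      with j , j∈ , z∈B ← ∈-union⁻ B ((J ∩ K) - i) z∈U
      with j∈J , j∈K ← x∈p∩q⁻ J K (x∈p-y⇒x∈p j∈) =
      x∈p∩q⁺ (x∈p∧x≢y⇒x∈p-y z∈X (avoid x∈B) , ∈-union⁺ j j∈J z∈B) ,
      x∈p∩q⁺ (x∈p∧x≢y⇒x∈p-y z∈X (avoid y∈B) , ∈-union⁺ j j∈K z∈B)
      where
      avoid : ∀ {w} → w ∈ B i → z ≢ w
      avoid w∈B refl = x∈p-y⇒x≢y j∈ (same-index z∈B w∈B)
    either : ∀ {z} → z ∈ I″ → z ∈ U ⊎ z ∈ V
    either z∈I″ with x∈p∪q⁻ I I′ (I″⊆ z∈I″)
    ... | inj₁ z∈I = inj₁ (proj₁ (both z∈I))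
    ... | inj₂ z∈I′ with z∈X , z∈U ← x∈p∩q⁻ X (union B (J ∪ K)) (I′⊆ z∈I′)
      with j , j∈ , z∈B ← ∈-union⁻ B (J ∪ K) z∈U
      with x∈p∪q⁻ J K j∈
    ... | inj₁ j∈J = in-J z∈X j∈J z∈B
    ... | inj₂ j∈K = in-K z∈X j∈K z∈B
    cover : I″ ⊆ (I″ ∩ U) ∪ (I″ ∩ V)
    cover z∈I″ with either z∈I″
    ... | inj₁ z∈P = p⊆p∪q (I″ ∩ V) (x∈p∩q⁺ (z∈I″ , z∈P))
    ... | inj₂ z∈Q = q⊆p∪q (I″ ∩ U) (I″ ∩ V) (x∈p∩q⁺ (z∈I″ , z∈Q))
    common : I ⊆ (I″ ∩ U) ∩ (I″ ∩ V)
    common z∈I = x∈p∩q⁺ ( x∈p∩q⁺ (I⊆I″ z∈I , proj₁ (both z∈I))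
                         , x∈p∩q⁺ (I⊆I″ z∈I , proj₂ (both z∈I)))
    submodular : ∣ J ∣ + ∣ K ∣ ≤ suc (∣ I″ ∩ U ∣ + ∣ I″ ∩ V ∣)
    submodular = begin
      ∣ J ∣ + ∣ K ∣                  ≡⟨ ∣p∪q∣+∣p∩q∣≡∣p∣+∣q∣ J K ⟨
      ∣ J ∪ K ∣ + ∣ J ∩ K ∣          ≤⟨ +-mono-≤ (≤-trans ∣J∪K∣≤ ∣I′∣≤)
                                          (≤-trans (∣p∣≤1+∣p-x∣ (J ∩ K) i) (s≤s ∣J∩K∣≤)) ⟩
      ∣ I″ ∣ + suc ∣ I ∣             ≡⟨ +-suc ∣ I″ ∣ ∣ I ∣ ⟩
      suc (∣ I″ ∣ + ∣ I ∣)           ≤⟨ s≤s (+-mono-≤ (p⊆q⇒∣p∣≤∣q∣ cover) (p⊆q⇒∣p∣≤∣q∣ common)) ⟩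
      suc (∣ (I″ ∩ U) ∪ (I″ ∩ V) ∣ + ∣ (I″ ∩ U) ∩ (I″ ∩ V) ∣)
                                     ≡⟨ cong suc (∣p∪q∣+∣p∩q∣≡∣p∣+∣q∣ (I″ ∩ U) (I″ ∩ V)) ⟩
      suc (∣ I″ ∩ U ∣ + ∣ I″ ∩ V ∣)  ∎
      where open ≤-Reasoning
    part : ∀ R → Indep M (I″ ∩ R)
    part R = indep-⊆ M (p∩q⊆p I″ R) II″
    pick : Rich (X - x) J ⊎ Rich (X - y) K
    pick with ∣ J ∣ ≤? ∣ I″ ∩ U ∣ | ∣ K ∣ ≤? ∣ I″ ∩ V ∣
    ... | yes ok | _      = inj₁ (I″ ∩ U , part U , p∩q⊆q I″ U , ok)
    ... | no _   | yes ok = inj₂ (I″ ∩ V , part V , p∩q⊆q I″ V , ok)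
    -- Two failures would cost two elements in total, while leaving out i has cost only one.
    ... | no ¬p  | no ¬q  = contradiction
      (≤-trans (s≤s (≤-reflexive (sym (+-suc ∣ I″ ∩ U ∣ ∣ I″ ∩ V ∣)))) (≤-trans (+-mono-≤ (≰⇒> ¬p) (≰⇒> ¬q)) submodular))
      (<-irrefl refl)

  -- While some `B i` contains two elements of X, one of the two can be deleted without losing
  -- Rado's condition. Once none does, the witness for J = ⊤ meets every `B i` exactly once. The
  -- bound s on |X| drives the recursion.
  transversal : ∀ s X → ∣ X ∣ ≤ s → (∀ J → Rich X J) →
                ∃ λ T → T ⊆ X × Indep M T × n ≤ ∣ T ∣ × (∀ i → ∣ T ∩ B i ∣ ≡ 1)
  transversal s X ∣X∣≤s rich with any? (λ i → 1 <? ∣ X ∩ B i ∣)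
  ... | no none with T , IT , T⊆ , n≤ ← rich ⊤ =
    T , p∩q⊆p X (union B ⊤) ∘ T⊆ , IT , n≤∣T∣ ,
    all-met-once n B T ≤1 (≤-trans n≤∣T∣ (p⊆q⇒∣p∣≤∣q∣ (λ z∈ → x∈p∩q⁺ (z∈ , p∩q⊆q X (union B ⊤) (T⊆ z∈)))))
    where
    n≤∣T∣ : n ≤ ∣ T ∣
    n≤∣T∣ = subst (_≤ ∣ T ∣) (∣⊤∣≡n n) n≤
    ≤1 : ∀ j → ∣ T ∩ B j ∣ ≤ 1
    ≤1 j = ≤-trans (p⊆q⇒∣p∣≤∣q∣ sub) (≮⇒≥ (λ lt → none (j , lt)))
      where
      sub : T ∩ B j ⊆ X ∩ B j
      sub z∈ with z∈T , z∈B ← x∈p∩q⁻ T (B j) z∈ = x∈p∩q⁺ (p∩q⊆p X (union B ⊤) (T⊆ z∈T) , z∈B)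
  transversal zero X ∣X∣≤0 rich | yes (i , 1<) =
    contradiction (≤-trans 1< (≤-trans (∣p∩q∣≤∣p∣ X (B i)) ∣X∣≤0)) λ ()
  transversal (suc s) X ∣X∣≤s rich | yes (i , 1<)
    with x , y , x∈ , y∈ , x≢y ← 1<∣p∣⇒two (X ∩ B i) 1<
    with ∀∀-⊎ n (delete-one rich (p∩q⊆q X (B i) x∈) (p∩q⊆q X (B i) y∈) x≢y)
  ... | inj₁ rich′ with T , T⊆ , rest ← transversal s (X - x) (s≤s⁻¹ (≤-trans (x∈p⇒∣p-x∣<∣p∣ (p∩q⊆p X (B i) x∈)) ∣X∣≤s)) rich′
      = T , (x∈p-y⇒x∈p ∘ T⊆) , rest
  ... | inj₂ rich′ with T , T⊆ , rest ← transversal s (X - y) (s≤s⁻¹ (≤-trans (x∈p⇒∣p-x∣<∣p∣ (p∩q⊆p X (B i) y∈)) ∣X∣≤s)) rich′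
      = T , (x∈p-y⇒x∈p ∘ T⊆) , rest

-- Enumeration of subsets and sizes of bases

∈-class⁺ : ∀ {t m} (c : Fin t) (χ : Vec (Fin t) m) {x} → lookup χ x ≡ c → x ∈ class c χ
∈-class⁺ c χ {x} eq = lookup⇒[]= x (class c χ) (trans (lookup-map x (λ i → does (i ≟ c)) χ) hit)
  where
  hit : does (lookup χ x ≟ c) ≡ inside
  hit with lookup χ x ≟ c
  ... | yes _ = refl
  ... | no ne = contradiction eq ne

∈-vectors : ∀ {a} {A : Set a} {xs : List A} → (∀ x → x List.∈ xs) → ∀ {n} (v : Vec A n) → v List.∈ vectors xs n
∈-vectors all []      = Any.here refl
∈-vectors all (x ∷ v) = ∈-cartesianProductWith⁺ _∷_ (all x) (∈-vectors all v)

∈-subsets : ∀ {n} (J : Subset n) → J List.∈ subsets n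
∈-subsets = ∈-vectors λ where
  outside → Any.here refl
  inside  → Any.there (Any.here refl)

∣p∣+∣∁p∣≡n : ∀ {n} (p : Subset n) → ∣ p ∣ + ∣ ∁ p ∣ ≡ n
∣p∣+∣∁p∣≡n p = trans (cong (∣ p ∣ +_) (∣∁p∣≡n∸∣p∣ p)) (m+[n∸m]≡n (∣p∣≤n p))

indep-size : ∀ {m n} (M : Matroid m) {A} → HasRank M n → Indep M A → ∣ A ∣ ≤ n
indep-size M {A} (B , (IB , max) , refl) IA with ∣ A ∣ ≤? ∣ B ∣
... | yes le = le
... | no ¬le with x , _ , x∉B , Ix ← indep-exch M IB IA (≰⇒> ¬le) = contradiction Ix (max x x∉B)

basis-size : ∀ {m n} (M : Matroid m) {A} → HasRank M n → IsBasis M A → ∣ A ∣ ≡ n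
basis-size M {A} rank@(B , (IB , _) , refl) (IA , max) with ∣ B ∣ ≤? ∣ A ∣
... | yes le = ≤-antisym (indep-size M rank IA) le
... | no ¬le with x , _ , x∉A , Ix ← indep-exch M IA IB (≰⇒> ¬le) = contradiction Ix (max x x∉A)

full⇒basis : ∀ {m n} (M : Matroid m) {A} → HasRank M n → Indep M A → n ≤ ∣ A ∣ → IsBasis M A
full⇒basis {n = n} M {A} rank IA n≤ = IA , λ x x∉A Ix → <-irrefl refl (begin-strict
  n                  ≤⟨ n≤ ⟩
  ∣ A ∣              <⟨ n<1+n ∣ A ∣ ⟩
  suc ∣ A ∣          ≡⟨ cong (_+ ∣ A ∣) (∣⁅x⁆∣≡1 x) ⟨
  ∣ ⁅ x ⁆ ∣ + ∣ A ∣  ≡⟨ ∣∪∣-disjoint (λ y y∈x → subst (_∉ A) (sym (x∈⁅y⁆⇒x≡y x y∈x)) x∉A) ⟨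
  ∣ ⁅ x ⁆ ∪ A ∣      ≤⟨ indep-size M rank Ix ⟩
  n                  ∎)
  where open ≤-Reasoning

-- The initial tests and their total weight

module Initial {m n k t} (M : Matroid m) (2≤n : 2 ≤ n) (n≤e^k : LeExp n (suc k))
             (6tk≤n : suc t * (6 * suc k) ≤ n) where

  -- At least d |J| for every initial test, so that (1+t)^K is a common denominator.
  K : ℕ
  K = suc n * n

  open Exposure M n t K public

  initial : Fin (suc t) → Subset n → Test n
  initial c J = record
    -- Here d = n + 1 - |J|, so that fewer than d missing elements means rank at least |J|; e pads
    -- the exponent up to K.
    { colour = c ; d = suc ∣ ∁ J ∣ ; e = K ∸ suc ∣ ∁ J ∣ * ∣ J ∣ ; u = n ; J = J ; I = ⊥
    ; indep = indep-∅ M ; size = cong (_+ n) (∣⊥∣≡0 m)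
    ; balance = m∸n+n≡m (*-mono-≤ (s≤s (∣p∣≤n (∁ J))) (∣p∣≤n J)) }

  tests : List (Test n)
  tests = cartesianProductWith initial (allFin (suc t)) (subsets n)

  p : ℕ
  p = suc k * suc t

  6p≤n : 6 * p ≤ n
  6p≤n = subst (_≤ n) (lemma (suc t) (suc k)) 6tk≤n
    where
    lemma : ∀ t k → t * (6 * k) ≡ 6 * (k * t)
    lemma = solve-∀

  size-weight : ∀ s d e → s + d ≡ n →
    (n C suc d) * (t ^ (suc d * s) * suc t ^ e) * n ^ (2 * suc n)
      ≤ suc t ^ (e + suc d * s) * (n * (n ^ 2) ^ d + (n ^ 2) ^ s)
  -- For empty J, d = n and the coefficient C(n,n+1) vanishes.
  size-weight zero d e refl = ≤-trans (≤-reflexive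
    (cong (λ c → c * (t ^ (suc d * 0) * suc t ^ e) * d ^ (2 * suc d)) (k>n⇒nCk≡0 (n<1+n d)))) z≤n
  size-weight (suc s) d e eq = weight-bound n p (n≤1+n t) (LeExp⇒decay n (suc k) t n≤e^k) 6p≤n s d e eq

  ∑-bound : ∑ (λ J → n * (n ^ 2) ^ ∣ ∁ J ∣ + (n ^ 2) ^ ∣ J ∣) (subsets n) ≡ suc n * (n ^ 2 + 1) ^ n
  ∑-bound = begin
    ∑ (λ J → n * (n ^ 2) ^ ∣ ∁ J ∣ + (n ^ 2) ^ ∣ J ∣) (subsets n)
      ≡⟨ ∑-+ (λ J → n * (n ^ 2) ^ ∣ ∁ J ∣) (λ J → (n ^ 2) ^ ∣ J ∣) (subsets n) ⟩
    ∑ (λ J → n * (n ^ 2) ^ ∣ ∁ J ∣) (subsets n) + ∑ (λ J → (n ^ 2) ^ ∣ J ∣) (subsets n)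
      ≡⟨ cong₂ _+_ (trans (∑-*ˡ n (λ J → (n ^ 2) ^ ∣ ∁ J ∣) (subsets n)) (cong (n *_) left)) right ⟩
    n * (n ^ 2 + 1) ^ n + (n ^ 2 + 1) ^ n
      ≡⟨ +-comm (n * (n ^ 2 + 1) ^ n) ((n ^ 2 + 1) ^ n) ⟩
    suc n * (n ^ 2 + 1) ^ n ∎
    where
    open ≡-Reasoning
    left : ∑ (λ J → (n ^ 2) ^ ∣ ∁ J ∣) (subsets n) ≡ (n ^ 2 + 1) ^ n
    left = begin
      ∑ (λ J → (n ^ 2) ^ ∣ ∁ J ∣) (subsets n)
        ≡⟨ ∑-cong (λ J → sym (trans (cong (_* (n ^ 2) ^ ∣ ∁ J ∣) (^-zeroˡ ∣ J ∣)) (*-identityˡ ((n ^ 2) ^ ∣ ∁ J ∣)))) (subsets n) ⟩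
      ∑ (λ J → 1 ^ ∣ J ∣ * (n ^ 2) ^ ∣ ∁ J ∣) (subsets n)
        ≡⟨ ∑-subsets 1 (n ^ 2) n ⟩
      (1 + n ^ 2) ^ n
        ≡⟨ cong (_^ n) (+-comm 1 (n ^ 2)) ⟩
      (n ^ 2 + 1) ^ n ∎
    right : ∑ (λ J → (n ^ 2) ^ ∣ J ∣) (subsets n) ≡ (n ^ 2 + 1) ^ n
    right = trans
      (∑-cong (λ J → sym (trans (cong ((n ^ 2) ^ ∣ J ∣ *_) (^-zeroˡ ∣ ∁ J ∣)) (*-identityʳ ((n ^ 2) ^ ∣ J ∣)))) (subsets n))
      (∑-subsets (n ^ 2) 1 n)

  -- The union bound. After multiplication by N = n^(2(n+1)), `size-weight` bounds each test,
  -- `∑-bound` adds up the subsets, and `total-bound` absorbs the t + 1 colours.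
  light : ∑ weight tests < suc t ^ K
  light = *-cancelˡ-< N _ _ (begin-strict
    N * ∑ weight tests
      ≡⟨ cong (N *_) (∑-cartesianProductWith weight initial (allFin (suc t)) (subsets n)) ⟩
    N * ∑ (λ c → ∑ (weight ∘ initial c) (subsets n)) (allFin (suc t))
      ≡⟨ ∑-*ˡ N (λ c → ∑ (weight ∘ initial c) (subsets n)) (allFin (suc t)) ⟨
    ∑ (λ c → N * ∑ (weight ∘ initial c) (subsets n)) (allFin (suc t))
      ≤⟨ ∑-mono colour-bound (allFin (suc t)) ⟩
    ∑ (λ _ → suc t ^ K * W) (allFin (suc t))
      ≡⟨ ∑-const (suc t ^ K * W) (allFin (suc t)) ⟩
    length (allFin (suc t)) * (suc t ^ K * W)
      ≡⟨ cong (_* (suc t ^ K * W)) (length-tabulate {n = suc t} id) ⟩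
    suc t * (suc t ^ K * W)
      ≡⟨ swap-middle (suc t) (suc t ^ K) W ⟩
    suc t ^ K * (suc t * W)
      <⟨ *-monoʳ-< (suc t ^ K) {{m^n≢0 (suc t) K}} (total-bound n (suc t) 2≤n 6t≤n) ⟩
    suc t ^ K * N
      ≡⟨ *-comm (suc t ^ K) N ⟩
    N * suc t ^ K ∎)
    where
    open ≤-Reasoning
    N W : ℕ
    N = n ^ (2 * suc n)
    W = suc n * (n ^ 2 + 1) ^ n
    6t≤n : 6 * suc t ≤ n
    6t≤n = ≤-trans (*-monoʳ-≤ 6 (m≤n*m (suc t) (suc k))) 6p≤n
    term : ∀ c J → N * weight (initial c J) ≤ suc t ^ K * (n * (n ^ 2) ^ ∣ ∁ J ∣ + (n ^ 2) ^ ∣ J ∣)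
    term c J = begin
      N * weight (initial c J)   ≡⟨ *-comm N (weight (initial c J)) ⟩
      weight (initial c J) * N   ≤⟨ size-weight ∣ J ∣ ∣ ∁ J ∣ (K ∸ suc ∣ ∁ J ∣ * ∣ J ∣) (∣p∣+∣∁p∣≡n J) ⟩
      suc t ^ (K ∸ suc ∣ ∁ J ∣ * ∣ J ∣ + suc ∣ ∁ J ∣ * ∣ J ∣) * (n * (n ^ 2) ^ ∣ ∁ J ∣ + (n ^ 2) ^ ∣ J ∣)
        ≡⟨ cong (λ e → suc t ^ e * (n * (n ^ 2) ^ ∣ ∁ J ∣ + (n ^ 2) ^ ∣ J ∣)) (Test.balance (initial c J)) ⟩
      suc t ^ K * (n * (n ^ 2) ^ ∣ ∁ J ∣ + (n ^ 2) ^ ∣ J ∣) ∎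
    colour-bound : ∀ c → N * ∑ (weight ∘ initial c) (subsets n) ≤ suc t ^ K * W
    colour-bound c = begin
      N * ∑ (weight ∘ initial c) (subsets n)
        ≡⟨ ∑-*ˡ N (weight ∘ initial c) (subsets n) ⟨
      ∑ (λ J → N * weight (initial c J)) (subsets n)
        ≤⟨ ∑-mono (term c) (subsets n) ⟩
      ∑ (λ J → suc t ^ K * (n * (n ^ 2) ^ ∣ ∁ J ∣ + (n ^ 2) ^ ∣ J ∣)) (subsets n)
        ≡⟨ ∑-*ˡ (suc t ^ K) (λ J → n * (n ^ 2) ^ ∣ ∁ J ∣ + (n ^ 2) ^ ∣ J ∣) (subsets n) ⟩
      suc t ^ K * ∑ (λ J → n * (n ^ 2) ^ ∣ ∁ J ∣ + (n ^ 2) ^ ∣ J ∣) (subsets n)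
        ≡⟨ cong (suc t ^ K *_) ∑-bound ⟩
      suc t ^ K * W ∎

-- All tests `initial c J` pass simultaneously. They start from the empty set, so every element of
-- the resulting I lies in a basis of J and has colour c.
rich-colouring : ∀ {m n k t} (M : Matroid m) (B : Fin n → Subset m) → 2 ≤ n → LeExp n (suc k) →
  suc t * (6 * suc k) ≤ n → (∀ j → Indep M (B j)) → (∀ j → ∣ B j ∣ ≡ n) →
  ∃ λ (χ : Fin n → Vec (Fin (suc t)) m) → ∀ c J → ∃ λ I → Indep M I × ∣ J ∣ ≤ ∣ I ∣ ×
    (∀ {x} → x ∈ I → ∃ λ j → j ∈ J × x ∈ B j × lookup (χ j) x ≡ c)
rich-colouring {n = n} {k} {t} M B 2≤n n≤e^k 6tk≤n IB ∣B∣ =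
  let χ , passes = all-pass n B IB ∣B∣ tests light in
  χ , λ c J → extract χ c J (All.lookup passes (∈-cartesianProductWith⁺ initial (∈-allFin c) (∈-subsets J)))
  where
  open Initial {k = k} {t} M 2≤n n≤e^k 6tk≤n
  extract : ∀ χ c J → Passes B χ (initial c J) → ∃ λ I → Indep M I × ∣ J ∣ ≤ ∣ I ∣ ×
            (∀ {x} → x ∈ I → ∃ λ j → j ∈ J × x ∈ B j × lookup (χ j) x ≡ c)
  extract χ c J (I , II , n< , ∈I) = I , II , large , λ x∈I → drop (∈I x∈I)
    where
    large : ∣ J ∣ ≤ ∣ I ∣
    large = +-cancelʳ-≤ (∣ ∁ J ∣) (∣ J ∣) (∣ I ∣)
      (subst (_≤ ∣ I ∣ + ∣ ∁ J ∣) (sym (∣p∣+∣∁p∣≡n J)) (s≤s⁻¹ (subst (n <_) (+-suc ∣ I ∣ ∣ ∁ J ∣) n<)))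
    drop : ∀ {x} {R : Set} → x ∈ ⊥ ⊎ R → R
    drop (inj₁ x∈⊥) = contradiction x∈⊥ ∉⊥
    drop (inj₂ r)   = r

-- Disjoint transversals from the colour classes

module _ {m n t} (M : Matroid m) (B : Fin n → Subset m) (disj : ∀ i j → i ≢ j → Disjoint (B i) (B j))
         (χ : Fin n → Vec (Fin t) m)
         (rich : ∀ c J → ∃ λ I → Indep M I × ∣ J ∣ ≤ ∣ I ∣ ×
                 (∀ {x} → x ∈ I → ∃ λ j → j ∈ J × x ∈ B j × lookup (χ j) x ≡ c)) where

  open Rado M B disj

  colourClass : Fin t → Subset m
  colourClass c = union (λ j → B j ∩ class c (χ j)) ⊤

  ∈-colourClass⁻ : ∀ {c x} → x ∈ colourClass c → ∃ λ j → x ∈ B j × lookup (χ j) x ≡ c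
  ∈-colourClass⁻ {c} x∈ with j , _ , x∈j ← ∈-union⁻ (λ j → B j ∩ class c (χ j)) ⊤ x∈
    with x∈B , x∈c ← x∈p∩q⁻ (B j) (class c (χ j)) x∈j = j , x∈B , ∈-class⁻ c (χ j) x∈c

  -- Disjointness of the bases determines the index j of an element, and `χ j` then determines its
  -- colour.
  colour-unique : ∀ {a b x} → x ∈ colourClass a → x ∈ colourClass b → a ≡ b
  colour-unique x∈a x∈b with i , x∈Bi , refl ← ∈-colourClass⁻ x∈a with j , x∈Bj , refl ← ∈-colourClass⁻ x∈b
    = cong (λ i → lookup (χ i) _) (same-index x∈Bi x∈Bj)

  colourClass-rich : ∀ c J → Rich (colourClass c) J
  colourClass-rich c J with I , II , ∣J∣≤ , ∈I ← rich c J = I , II , I⊆ , ∣J∣≤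
    where
    I⊆ : I ⊆ colourClass c ∩ union B J
    I⊆ x∈I with j , j∈J , x∈B , col ← ∈I x∈I = x∈p∩q⁺
      (∈-union⁺ j ∈⊤ (x∈p∩q⁺ (x∈B , ∈-class⁺ c (χ j) col)) , ∈-union⁺ j j∈J x∈B)

  disjoint-transversals : HasRank M n → Σ (Fin t → Subset m) λ T →
    (∀ a → IsTransversalBasis M B (T a)) × (∀ a b → a ≢ b → Disjoint (T a) (T b))
  disjoint-transversals rank =
    (λ a → proj₁ (found a)) ,
    (λ a → let _ , _ , IT , n≤ , once = found a in full⇒basis M rank IT n≤ , once) ,
    λ a b a≢b x x∈a x∈b → a≢b (colour-unique (proj₁ (proj₂ (found a)) x∈a) (proj₁ (proj₂ (found b)) x∈b))
    where
    found : ∀ a → ∃ λ T → T ⊆ colourClass a × Indep M T × n ≤ ∣ T ∣ × (∀ i → ∣ T ∩ B i ∣ ≡ 1)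
    found a = transversal ∣ colourClass a ∣ (colourClass a) ≤-refl (colourClass-rich a)

-- With k = ⌈log n⌉ the condition on t says t ≤ ⌊n/(6k)⌋.
theorem2 : (n : ℕ) → 2 ≤ n → (k : ℕ) → CeilLog n k →
    (m : ℕ) (M : Matroid m) → HasRank M n →
    (B : Fin n → Subset m) → (∀ i → IsBasis M (B i)) →
    (∀ i j → i ≢ j → Disjoint (B i) (B j)) →
    (t : ℕ) → t * (6 * k) ≤ n →
    Σ (Fin t → Subset m) λ T →
    (∀ a → IsTransversalBasis M B (T a)) ×
    (∀ a b → a ≢ b → Disjoint (T a) (T b))
theorem2 n 2≤n zero    n≤1 = contradiction (≤-trans 2≤n n≤1) (<-irrefl refl)
-- The colouring argument works with at least one colour, so t = 0 is treated apart with the empty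
-- family.
theorem2 n 2≤n (suc k) (_ , n≤e^k) m M rank B basis disj zero    _     = (λ ()) , (λ ()) , (λ ())
theorem2 n 2≤n (suc k) (_ , n≤e^k) m M rank B basis disj (suc t) 6tk≤n =
  let χ , rich = rich-colouring M B 2≤n n≤e^k 6tk≤n (proj₁ ∘ basis) (λ i → basis-size M rank (basis i))
  in disjoint-transversals M B disj χ rich rank
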